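{- Satisfiability of $\mathrm{MITL}[\mathsf F_0]$ (and hence also of $\mathrm{MITL}[\mathsf F_{0,\infty}]$ and $\mathrm{MITL}[\mathsf F_{0,\infty},\mathsf P_{0,\infty}]$) is PSPACE-hard.
   Context: Timed words: let $\Sigma$ be a finite alphabet. A timed word over $\Sigma$ is a finite nonempty sequence $\rho=(\sigma_1,\tau_1)\cdots(\sigma_n,\tau_n)$ with $\sigma_i\in\Sigma$ and real time stamps $0=\tau_1<\tau_2<\cdots<\tau_n$ (strictly monotonic time). Logics: formulas are $\phi::= a\mid \phi\lor\phi\mid\neg\phi\mid \mathsf F_I\phi\mid \mathsf P_I\phi$ with $a\in\Sigma$ and $I$ a non-singular interval with non-negative integer endpoints, right endpoint possibly $\infty$. Semantics: $\rho,i\models a$ iff $\sigma_i=a$; Boolean connectives as usual; $\rho,i\models\mathsf F_I\phi$ iff there is $j>i$ with $\tau_j-\tau_i\in I$ and $\rho,j\models\phi$; $\rho,i\models\mathsf P_I\phi$ iff there is $j<i$ with $\tau_i-\tau_j\in I$ and $\rho,j\models\phi$. - $\mathrm{MITL}[\mathsf F_{0,\infty},\mathsf P_{0,\infty}]$: every interval is of the form $[0,u\rangle$ (i.e. $[0,u)$ or $[0,u]$) or $\langle l,\infty)$ (i.e. $(l,\infty)$ or $[l,\infty)$). - $\mathrm{MITL}[\mathsf F_{0,\infty}]$: its fragment without $\mathsf P_I$. - $\mathrm{MITL}[\mathsf F_0]$: no $\mathsf P_I$, and every interval (bounded or unbounded) is of the upper-bound form $[0,u\rangle$, with $u=\infty$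 (i.e. $[0,\infty)$) allowed. A formula $\phi$ is satisfiable if $\rho,1\models\phi$ for some timed word $\rho$. The satisfiability problem takes as input a formula (over a finite alphabet that is part of the input) with time constants written in binary. -}

module Defs where

open import Data.Bool using (Bool; true; false)
open import Data.Empty using (⊥)
open import Data.Unit using (⊤)
open import Data.Fin as Fin using (Fin; zero; suc; toℕ)
open import Data.Digit using (Bit; 0b; 1b; toDigits)
open import Data.Integer as ℤ using (+_)
open import Data.List using (List; []; _∷_; [_]; _++_; length; map; replicate)
open import Data.Maybe using (Maybe; nothing; just)
open import Data.Nat as ℕ using (ℕ; zero; suc)
import Data.Nat.Tactic.RingSolver as ℕ-Ring
open import Data.Product using (Σ-syntax; ∃-syntax; _×_; _,_; proj₁)
open import Data.Rational.Unnormalised as ℚ using (ℚᵘ; mkℚᵘ; *≡*)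
import Data.Rational.Unnormalised.Properties as ℚ
import Data.Rational.Unnormalised.Solver as ℚ
open import Data.Sum using (_⊎_; inj₁)
open import Data.Vec as Vec using (Vec; _∷_)
open import Function using (_↔_; _⇔_)
open import Relation.Binary.PropositionalEquality using (_≡_; refl; cong)
open import Relation.Nullary using (¬_)

-- Real numbers as regular Cauchy sequences of rationals (Bishop), with the
-- index shifted by one: the n-th term is within 1/(n+1) of the limit.

1/1+_ : ℕ → ℚᵘ
1/1+ n = mkℚᵘ (+ 1) n

record ℝ : Set where
  constructor mkℝ
  field
    seq     : ℕ → ℚᵘ
    regular : ∀ m n → ℚ.∣ seq m ℚ.- seq n ∣ ℚ.≤ 1/1+ m ℚ.+ 1/1+ n

open ℝ public

module Real where

  infix 4 _<_ _≤_ _≃_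
  infixl 6 _-_

  _<_ : ℝ → ℝ → Set
  x < y = ∃[ n ] 1/1+ n ℚ.+ 1/1+ n ℚ.< seq y n ℚ.- seq x n

  _≤_ : ℝ → ℝ → Set
  x ≤ y = ∀ n → seq x n ℚ.- seq y n ℚ.≤ 1/1+ n ℚ.+ 1/1+ n

  _≃_ : ℝ → ℝ → Set
  x ≃ y = x ≤ y × y ≤ x

  fromℕ : ℕ → ℝ
  fromℕ k = mkℝ (λ _ → q) λ m n → begin
    ℚ.∣ q ℚ.- q ∣          ≃⟨ ℚ.∣-∣-cong (ℚ.+-inverseʳ q) ⟩
    ℚ.0ℚᵘ                  ≤⟨ ℚ.nonNegative⁻¹ (1/1+ m ℚ.+ 1/1+ n) ⟩
    1/1+ m ℚ.+ 1/1+ n      ∎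
    where
    open ℚ.≤-Reasoning
    q = mkℚᵘ (+ k) 0

  private
    half : ∀ n → 1/1+ suc (n ℕ.+ n) ℚ.+ 1/1+ suc (n ℕ.+ n) ℚ.≃ 1/1+ n
    half n = *≡* (cong +_ (lemma n))
      where
      lemma : ∀ n → (2 ℕ.+ (n ℕ.+ n) ℕ.+ 0 ℕ.+ (2 ℕ.+ (n ℕ.+ n) ℕ.+ 0)) ℕ.* suc n
                    ≡ (2 ℕ.+ (n ℕ.+ n)) ℕ.* (2 ℕ.+ (n ℕ.+ n)) ℕ.+ 0
      lemma = ℕ-Ring.solve-∀

    rearrange : ∀ a b c d → (a ℚ.- b) ℚ.- (c ℚ.- d) ℚ.≃ (a ℚ.- c) ℚ.- (b ℚ.- d)
    rearrange = solve 4 (λ a b c d → (a :- b) :- (c :- d) := (a :- c) :- (b :- d)) ℚ.≃-refl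
      where open ℚ.+-*-Solver

    pair : ∀ a b → (a ℚ.+ b) ℚ.+ (a ℚ.+ b) ℚ.≃ (a ℚ.+ a) ℚ.+ (b ℚ.+ b)
    pair = solve 2 (λ a b → (a :+ b) :+ (a :+ b) := (a :+ a) :+ (b :+ b)) ℚ.≃-refl
      where open ℚ.+-*-Solver

  -- Reading both sequences at index 2n+1 halves each error.
  _-_ : ℝ → ℝ → ℝ
  x - y = mkℝ (λ n → seq x (suc (n ℕ.+ n)) ℚ.- seq y (suc (n ℕ.+ n))) λ m n →
    let a = suc (m ℕ.+ m); b = suc (n ℕ.+ n) in begin
    ℚ.∣ (seq x a ℚ.- seq y a) ℚ.- (seq x b ℚ.- seq y b) ∣
      ≃⟨ ℚ.∣-∣-cong (rearrange (seq x a) (seq y a) (seq x b) (seq y b)) ⟩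
    ℚ.∣ (seq x a ℚ.- seq x b) ℚ.- (seq y a ℚ.- seq y b) ∣
      ≤⟨ ℚ.∣p-q∣≤∣p∣+∣q∣ (seq x a ℚ.- seq x b) (seq y a ℚ.- seq y b) ⟩
    ℚ.∣ seq x a ℚ.- seq x b ∣ ℚ.+ ℚ.∣ seq y a ℚ.- seq y b ∣
      ≤⟨ ℚ.+-mono-≤ (regular x a b) (regular y a b) ⟩
    (1/1+ a ℚ.+ 1/1+ b) ℚ.+ (1/1+ a ℚ.+ 1/1+ b)
      ≃⟨ pair (1/1+ a) (1/1+ b) ⟩
    (1/1+ a ℚ.+ 1/1+ a) ℚ.+ (1/1+ b ℚ.+ 1/1+ b)
      ≃⟨ ℚ.+-cong (half m) (half n) ⟩
    1/1+ m ℚ.+ 1/1+ n ∎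
    where open ℚ.≤-Reasoning

record TimedWord (k : ℕ) : Set where
  field
    last   : ℕ
    letter : Fin (suc last) → Fin k
    time   : Fin (suc last) → ℝ
    start  : time zero Real.≃ Real.fromℕ 0
    strict : ∀ i j → i Fin.< j → time i Real.< time j

  Position : Set
  Position = Fin (suc last)

data Bracket : Set where
  closed open′ : Bracket

-- With integer endpoints, a bounded interval is nonempty and non-singular
-- exactly when l < u.
data Interval : Set where
  bounded   : Bracket → (l : ℕ) → Bracket → (u : ℕ) → .(l ℕ.< u) → Interval
  unbounded : Bracket → (l : ℕ) → Interval

Below : Bracket → ℝ → ℝ → Set
Below closed x y = x Real.≤ y
Below open′  x y = x Real.< y

infix 4 _∈ᴵ_
_∈ᴵ_ : ℝ → Interval → Set
x ∈ᴵ bounded b l c u _ = Below b (Real.fromℕ l) x × Below c x (Real.fromℕ u)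
x ∈ᴵ unbounded b l     = Below b (Real.fromℕ l) x

data Formula (k : ℕ) : Set where
  atom : Fin k → Formula k
  _∨′_ : Formula k → Formula k → Formula k
  ¬′_  : Formula k → Formula k
  F P  : Interval → Formula k → Formula k

module _ {k : ℕ} (ρ : TimedWord k) where
  open TimedWord ρ

  infix 4 _⊨_
  _⊨_ : Position → Formula k → Set
  i ⊨ atom a   = letter i ≡ a
  i ⊨ (φ ∨′ ψ) = (i ⊨ φ) ⊎ (i ⊨ ψ)
  i ⊨ (¬′ φ)   = ¬ (i ⊨ φ)
  i ⊨ F I φ    = ∃[ j ] (i Fin.< j × (time j Real.- time i) ∈ᴵ I × j ⊨ φ)
  i ⊨ P I φ    = ∃[ j ] (j Fin.< i × (time i Real.- time j) ∈ᴵ I × j ⊨ φ)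

Satisfiable : ∀ {k} → Formula k → Set
Satisfiable {k} φ = Σ[ ρ ∈ TimedWord k ] _⊨_ ρ zero φ

record Fragment : Set₁ where
  field
    FutureInterval PastInterval : Interval → Set

module _ (L : Fragment) where
  open Fragment L

  InFragment : ∀ {k} → Formula k → Set
  InFragment (atom a) = ⊤
  InFragment (φ ∨′ ψ) = InFragment φ × InFragment ψ
  InFragment (¬′ φ)   = InFragment φ
  InFragment (F I φ)  = FutureInterval I × InFragment φ
  InFragment (P I φ)  = PastInterval I × InFragment φ

data UpperBound : Interval → Set where
  [0,u⟩ : ∀ {c u} .{p : 0 ℕ.< u} → UpperBound (bounded closed 0 c u p)
  [0,∞⟩ : UpperBound (unbounded closed 0)

data OneSided : Interval → Set where
  [0,u⟩ : ∀ {c u} .{p : 0 ℕ.< u} → OneSided (bounded closed 0 c u p)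
  ⟨l,∞⟩ : ∀ {b l} → OneSided (unbounded b l)

MITL[F₀] MITL[F₀,∞] MITL[F₀,∞,P₀,∞] : Fragment
MITL[F₀]        = record { FutureInterval = UpperBound ; PastInterval = λ _ → ⊥ }
MITL[F₀,∞]      = record { FutureInterval = OneSided   ; PastInterval = λ _ → ⊥ }
MITL[F₀,∞,P₀,∞] = record { FutureInterval = OneSided   ; PastInterval = OneSided }

Language : Set → Set₁
Language A = List A → Set

-- An instance is the alphabet followed by the formula in Polish notation.
-- Since the alphabet is listed, one mark per letter, naming the i-th letter
-- by i marks is polynomially equivalent to any other naming.  Time constants
-- are in binary, least significant digit first.

data Token : Set where
  mark stop bit0 bit1 disj neg future past closed open′ infinity : Token

encodeUnary : ℕ → List Token
encodeUnary n = replicate n mark ++ [ stop ]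

encodeBit : Bit → Token
encodeBit zero       = bit0
encodeBit (suc zero) = bit1

encodeBinary : ℕ → List Token
encodeBinary n = map encodeBit (proj₁ (toDigits 2 n)) ++ [ stop ]

encodeBracket : Bracket → Token
encodeBracket closed = closed
encodeBracket open′  = open′

encodeInterval : Interval → List Token
encodeInterval (bounded b l c u _) =
  encodeBracket b ∷ encodeBinary l ++ encodeBracket c ∷ encodeBinary u
encodeInterval (unbounded b l) =
  encodeBracket b ∷ encodeBinary l ++ [ infinity ]

encodeFormula : ∀ {k} → Formula k → List Token
encodeFormula (atom a) = encodeUnary (toℕ a)
encodeFormula (φ ∨′ ψ) = disj ∷ encodeFormula φ ++ encodeFormula ψ
encodeFormula (¬′ φ)   = neg ∷ encodeFormula φ
encodeFormula (F I φ)  = future ∷ encodeInterval I ++ encodeFormula φ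
encodeFormula (P I φ)  = past ∷ encodeInterval I ++ encodeFormula φ

encode : ∀ k → Formula k → List Token
encode k φ = encodeUnary k ++ encodeFormula φ

Satisfiability : Fragment → Language Token
Satisfiability L w =
  ∃[ k ] Σ[ φ ∈ Formula k ] (InFragment L φ × w ≡ encode k φ × Satisfiable φ)

Finite : Set → Set
Finite A = ∃[ n ] (A ↔ Fin n)

data Move : Set where
  left stay right : Move

-- A two-way infinite tape, of which only the cells that held the input or
-- have been visited are represented; all others are blank.  The cells to the
-- left of the head are listed nearest first.
record Tape (S : Set) : Set where
  constructor tape
  field
    before : List S
    head   : S
    after  : List S

module _ {S : Set} where

  size : Tape S → ℕ
  size (tape ls _ rs) = length ls ℕ.+ suc (length rs)

  fromList : (blank : S) → List S → Tape S
  fromList blank []       = tape [] blank []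
  fromList blank (s ∷ ss) = tape [] s ss

  writeMove : (blank : S) → Tape S → S × Move → Tape S
  writeMove blank (tape ls       _ rs)       (s , stay)  = tape ls s rs
  writeMove blank (tape []       _ rs)       (s , left)  = tape [] blank (s ∷ rs)
  writeMove blank (tape (l ∷ ls) _ rs)       (s , left)  = tape ls l (s ∷ rs)
  writeMove blank (tape ls       _ [])       (s , right) = tape (s ∷ ls) blank []
  writeMove blank (tape ls       _ (r ∷ rs)) (s , right) = tape (s ∷ ls) r rs

-- Deterministic multitape Turing machines with input alphabet A.  The tape
-- alphabet is A, the set Work and the blank; the input is initially on the
-- first tape.  A step may also append a string over B (one of finitely many,
-- as a step depends only on the state and the scanned symbols) to a
-- write-only output.
record Machine (A B : Set) : Set₁ where
  field
    State Work  : Set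
    finiteState : Finite State
    finiteWork  : Finite Work
    extraTapes  : ℕ

  Symbol : Set
  Symbol = Maybe (A ⊎ Work)

  blank : Symbol
  blank = nothing

  tapes : ℕ
  tapes = suc extraTapes

  field
    initialState : State
    accepting    : State → Bool
    -- nothing means that the machine halts
    transition   : State → Vec Symbol tapes → Maybe (State × Vec (Symbol × Move) tapes × List B)

module _ {A B : Set} (M : Machine A B) where
  open Machine M

  Config : Set
  Config = State × Vec (Tape Symbol) tapes

  initial : List A → Config
  initial w = initialState ,
    fromList blank (map (λ a → just (inj₁ a)) w) ∷ Vec.replicate extraTapes (fromList blank [])

  cells : Config → ℕ
  cells (_ , ts) = Vec.sum (Vec.map size ts)

  next : Config → Maybe (Config × List B)
  next (q , ts) with transition q (Vec.map Tape.head ts)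
  ... | nothing             = nothing
  ... | just (q′ , as , w) = just ((q′ , Vec.zipWith (writeMove blank) ts as) , w)

  -- Complete runs, ending in a halting configuration.
  data Run (c : Config) : Set where
    halt : next c ≡ nothing → Run c
    step : ∀ {c′ w} → next c ≡ just (c′ , w) → Run c′ → Run c

module _ {A B : Set} {M : Machine A B} where

  time : ∀ {c} → Run M c → ℕ
  time (halt _)   = 0
  time (step _ r) = suc (time r)

  space : ∀ {c} → Run M c → ℕ
  space {c} (halt _)   = cells M c
  space {c} (step _ r) = cells M c ℕ.⊔ space r

  output : ∀ {c} → Run M c → List B
  output (halt _)           = []
  output (step {w = w} _ r) = w ++ output r

  accepts : ∀ {c} → Run M c → Bool
  accepts {q , _} (halt _) = Machine.accepting M q
  accepts (step _ r)       = accepts r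

-- Every polynomial is dominated by one of this form.
polynomial : ℕ → ℕ → ℕ → ℕ
polynomial c d n = c ℕ.* n ℕ.^ d ℕ.+ c

PSPACE : ∀ {A} → Language A → Set₁
PSPACE {A} L = Σ[ M ∈ Machine A ⊥ ]
  ∃[ c ] ∃[ d ] ∀ w → Σ[ r ∈ Run M (initial M w) ]
    (space r ℕ.≤ polynomial c d (length w) × (L w ⇔ accepts r ≡ true))

PolynomialTime : ∀ {A B} → (List A → List B) → Set₁
PolynomialTime {A} {B} f = Σ[ M ∈ Machine A B ]
  ∃[ c ] ∃[ d ] ∀ w → Σ[ r ∈ Run M (initial M w) ]
    (time r ℕ.≤ polynomial c d (length w) × output r ≡ f w)

infix 4 _≤ₚ_
_≤ₚ_ : ∀ {A B} → Language A → Language B → Set₁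
_≤ₚ_ {A} {B} L K = Σ[ f ∈ (List A → List B) ] (PolynomialTime f × (∀ w → L w ⇔ K (f w)))

PSPACE-hard : ∀ {B} → Language B → Set₁
PSPACE-hard K = ∀ {A} → Finite A → (L : Language A) → PSPACE L → L ≤ₚ K

-- Requiring consecutive positions to be at distance at least 1 makes F_[0,1] the
-- next operator, so it suffices to describe accepting runs in the linear temporal
-- logic of "next" and "always" on finite words.  A run of a machine in polynomial
-- space is written as a sequence of blocks of polynomial length m, one per
-- configuration, with all tapes shifted so that their heads are in column 0.  Then
-- the letter at t + m + 1 is a function of those at t, t + 1, t + 2 and t + m, and
-- the formula requires this of every letter t that is not an accepting verdict.
-- As words are finite, it is satisfiable exactly if such a verdict is reached.
module Submission where

open import Defs
open import Data.Bool using (Bool; true; false)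
open import Data.Bool.Properties using (¬-not)
open import Data.Digit using (Bit; toDigits; fromDigits)
open import Data.Empty using (⊥)
open import Data.Fin as Fin using (Fin; zero; suc; toℕ; fromℕ<)
open import Data.Fin.Properties as Fin
  using (toℕ-injective; toℕ-fromℕ<; toℕ<n; +↔⊎; *↔×; 0↔⊥; 1↔⊤; 2↔Bool)
open import Data.Integer as ℤ using ()
import Data.Integer.Properties as ℤ
import Data.Integer.Tactic.RingSolver as ℤ-Ring
open import Data.List as List
  using (List; []; _∷_; [_]; _++_; _ʳ++_; map; length; concat; concatMap; allFin)
open import Data.List.Membership.Propositional using (_∈_)
open import Data.List.Membership.Propositional.Properties using (∈-allFin)
open import Data.List.Properties as List
  using (++-assoc; ++-identityʳ; ∷-injective; ∷-injectiveʳ; length-ʳ++; concatMap-cong; concatMap-++;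
         concatMap-map; length-++; length-map; length-replicate)
open import Data.List.Relation.Unary.Any using (here; there)
open import Data.Maybe as Maybe using (Maybe; nothing; just; maybe′)
open import Data.Nat as ℕ using (ℕ; zero; suc; _+_; _*_; _^_; _≤_; _<_; z≤n; s≤s; s≤s⁻¹)
open import Data.Nat.Properties as ℕ
import Data.Nat.Tactic.RingSolver as ℕ-Ring
open import Data.Product using (Σ-syntax; ∃-syntax; _×_; _,_; proj₁; proj₂; uncurry)
open import Data.Product.Function.NonDependent.Propositional using (_×-↔_)
open import Data.Rational.Unnormalised as ℚ using (ℚᵘ; mkℚᵘ; *≡*; *<*; *≤*; 0ℚᵘ)
import Data.Rational.Unnormalised.Properties as ℚ
import Data.Rational.Unnormalised.Solver as ℚ
open import Data.Sum using (_⊎_; inj₁; inj₂)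
open import Data.Sum.Function.Propositional using (_⊎-↔_)
open import Data.Sum.Properties using (inj₁-injective)
open import Data.Unit using (⊤; tt)
open import Data.Vec as Vec using (Vec; []; _∷_; replicate; zipWith; lookup; tabulate)
open import Data.Vec.Properties as Vec
  using (zipWith-replicate; lookup-map; lookup-zipWith; tabulate-cong; tabulate∘lookup; map-∘; map-cong)
open import Function using (_∘_; _↔_; mk↔ₛ′; mk⇔; Inverse; Equivalence)
open import Function.Properties.Inverse using (↔-refl; ↔-sym; ↔-trans)
open import Relation.Binary.PropositionalEquality
  using (_≡_; _≢_; refl; sym; trans; cong; cong₂; subst; module ≡-Reasoning)
open import Relation.Nullary using (¬_; yes; no; contradiction)

-- Real numbers

-- With all heads in column 0, a move shifts a whole tape, so a column far from the control state
-- must still know which action was taken. Hence every letter carries the actions, and the rule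
-- hands them rightwards through the new block; this is why it reads the letter at t + m. A verdict
-- spreads in the same way, so a halted run goes on as a constant sequence. The operator F is
-- strict. What the formula demands everywhere therefore says nothing about position 0, not even
-- about its spacing, and the run is described from the first position reached after it. The
-- semantics is read constructively. Conjunction is expressed by negation and disjunction, so a
-- model gives up its information only under double negations. This suffices: acceptance is a
-- Boolean, and it is enough to refute that a rejecting run has a model. An instance of the problem
-- is a string that encodes some satisfiable formula, so the encoding must also be shown to be
-- uniquely decodable.

1/1+-archimedean : ∀ {δ} → 0ℚᵘ ℚ.< δ → ∃[ n ] 1/1+ n ℚ.< δ
1/1+-archimedean {mkℚᵘ (ℤ.+ zero) d} (*<* (ℤ.+<+ ()))
-- The representation `mkℚᵘ p d` has denominator d + 1, so the witness is 1/(d+2), which is less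
-- than 1/(d+1) and hence than δ.
1/1+-archimedean {mkℚᵘ (ℤ.+ suc p) d} _ = suc d , *<* (ℤ.+<+ (begin-strict
  suc d ℕ.+ 0                ≡⟨ ℕ.+-identityʳ (suc d) ⟩
  suc d                     <⟨ ℕ.n<1+n _ ⟩
  suc (suc d)               ≤⟨ ℕ.m≤m+n _ _ ⟩
  suc p ℕ.* suc (suc d)     ∎))
  where open ℕ.≤-Reasoning
1/1+-archimedean {mkℚᵘ ℤ.-[1+ p ] d} (*<* ())

p≤∣p∣ : ∀ p → p ℚ.≤ ℚ.∣ p ∣
p≤∣p∣ (mkℚᵘ (ℤ.+ n) d)    = ℚ.≤-refl
p≤∣p∣ (mkℚᵘ ℤ.-[1+ n ] d) = *≤* ℤ.-≤+

module _ where
  open ℚ.≤-Reasoning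
  open ℚ.+-*-Solver

  private
    ∣p-q∣≤r⇒p≤r+q : ∀ p q {r} → ℚ.∣ p ℚ.- q ∣ ℚ.≤ r → p ℚ.≤ r ℚ.+ q
    ∣p-q∣≤r⇒p≤r+q p q {r} h = begin
      p               ≃⟨ solve 2 (λ p q → p := (p :- q) :+ q) ℚ.≃-refl p q ⟩
      (p ℚ.- q) ℚ.+ q ≤⟨ ℚ.+-monoˡ-≤ q (ℚ.≤-trans (p≤∣p∣ _) h) ⟩
      r ℚ.+ q         ∎

    p<q⇒0<q-p : ∀ {p q} → p ℚ.< q → 0ℚᵘ ℚ.< q ℚ.- p
    p<q⇒0<q-p {p} {q} p<q = begin-strict
      0ℚᵘ     ≃⟨ ℚ.+-inverseʳ p ⟨
      p ℚ.- p <⟨ ℚ.+-monoˡ-< (ℚ.- p) p<q ⟩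
      q ℚ.- p ∎

    gap-transfer : ∀ x x′ y y′ e e′ → x′ ℚ.≤ (e′ ℚ.+ e) ℚ.+ x → y ℚ.≤ (e ℚ.+ e′) ℚ.+ y′ →
      (y ℚ.- x) ℚ.- (e ℚ.+ e) ℚ.≤ (y′ ℚ.- x′) ℚ.+ (e′ ℚ.+ e′)
    gap-transfer x x′ y y′ e e′ hx hy = begin
      (y ℚ.- x) ℚ.- (e ℚ.+ e)
        ≤⟨ ℚ.+-monoˡ-≤ (ℚ.- (e ℚ.+ e)) (ℚ.+-monoˡ-≤ (ℚ.- x) hy) ⟩
      ((e ℚ.+ e′) ℚ.+ y′ ℚ.- x) ℚ.- (e ℚ.+ e)
        ≃⟨ solve 4 (λ x y′ e e′ → ((e :+ e′) :+ y′ :- x) :- (e :+ e)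
             := (y′ :- ((e′ :+ e) :+ x)) :+ (e′ :+ e′)) ℚ.≃-refl x y′ e e′ ⟩
      (y′ ℚ.- ((e′ ℚ.+ e) ℚ.+ x)) ℚ.+ (e′ ℚ.+ e′)
        ≤⟨ ℚ.+-monoˡ-≤ (e′ ℚ.+ e′) (ℚ.+-monoʳ-≤ y′ (ℚ.neg-mono-≤ hx)) ⟩
      (y′ ℚ.- x′) ℚ.+ (e′ ℚ.+ e′) ∎

    0≤δ≤d+e⇒0-d≤e : ∀ {δ} d e → 0ℚᵘ ℚ.< δ → δ ℚ.≤ d ℚ.+ e → 0ℚᵘ ℚ.- d ℚ.≤ e
    0≤δ≤d+e⇒0-d≤e {δ} d e 0<δ h = begin
      0ℚᵘ ℚ.- d        ≤⟨ ℚ.+-monoˡ-≤ (ℚ.- d) (ℚ.≤-trans (ℚ.<⇒≤ 0<δ) h) ⟩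
      d ℚ.+ e ℚ.- d    ≃⟨ solve 2 (λ d e → d :+ e :- d := e) ℚ.≃-refl d e ⟩
      e                ∎

  -- The witness of a strict inequality concerns a single index k. Regularity carries its surplus δ
  -- to every other index n at the price of the error terms of n alone, which is needed because
  -- subtraction reads its arguments at shifted indices.
  <-gap : ∀ {x y} (x<y : x Real.< y) →
    ∃[ δ ] (0ℚᵘ ℚ.< δ × ∀ n → δ ℚ.≤ (seq y n ℚ.- seq x n) ℚ.+ (1/1+ n ℚ.+ 1/1+ n))
  <-gap {x} {y} (k , p) = (seq y k ℚ.- seq x k) ℚ.- (1/1+ k ℚ.+ 1/1+ k) , p<q⇒0<q-p p , λ n →
    gap-transfer (seq x k) (seq x n) (seq y k) (seq y n) (1/1+ k) (1/1+ n)
      (∣p-q∣≤r⇒p≤r+q (seq x n) (seq x k) (regular x n k))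
      (∣p-q∣≤r⇒p≤r+q (seq y k) (seq y n) (regular y k n))

  private
    -- The n-th term of a difference is that of its arguments at index odd n.
    odd : ℕ → ℕ
    odd n = suc (n ℕ.+ n)

    2/odd≤ : ∀ n → 1/1+ odd n ℚ.+ 1/1+ odd n ℚ.≤ 1/1+ n
    2/odd≤ n = ℚ.≤-reflexive (*≡* (cong ℤ.+_ (lemma n)))
      where
      lemma : ∀ n → (2 ℕ.+ (n ℕ.+ n) ℕ.+ 0 ℕ.+ (2 ℕ.+ (n ℕ.+ n) ℕ.+ 0)) ℕ.* suc n
                    ≡ (2 ℕ.+ (n ℕ.+ n)) ℕ.* (2 ℕ.+ (n ℕ.+ n)) ℕ.+ 0
      lemma = ℕ-Ring.solve-∀

    2/odd≤2/ : ∀ n → 1/1+ odd n ℚ.+ 1/1+ odd n ℚ.≤ 1/1+ n ℚ.+ 1/1+ n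
    2/odd≤2/ n = ℚ.≤-trans (2/odd≤ n) (ℚ.p≤p+q (1/1+ n) (1/1+ n))

  <⇒0≤- : ∀ {x y} → x Real.< y → Real.fromℕ 0 Real.≤ y Real.- x
  <⇒0≤- {x} {y} x<y n = let δ , 0<δ , gap = <-gap {x} {y} x<y in
    ℚ.≤-trans (0≤δ≤d+e⇒0-d≤e (seq y (odd n) ℚ.- seq x (odd n)) (1/1+ odd n ℚ.+ 1/1+ odd n) 0<δ (gap (odd n)))
      (2/odd≤2/ n)

  private
    <-by-quarters : ∀ {δ} d x y z u → 0ℚᵘ ℚ.≤ d → (d ℚ.+ d) ℚ.+ (d ℚ.+ d) ℚ.< δ →
      δ ℚ.≤ (y ℚ.- x) ℚ.+ d → (y ℚ.- z) ℚ.- u ℚ.≤ d → d ℚ.< u ℚ.- (x ℚ.- z)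
    <-by-quarters {δ} d x y z u 0≤d 4d<δ h₁ h₂ = begin-strict
      d                                                 ≃⟨ ℚ.+-identityʳ d ⟨
      d ℚ.+ 0ℚᵘ                                         ≤⟨ ℚ.+-monoʳ-≤ d 0≤d ⟩
      d ℚ.+ d
        ≃⟨ solve 1 (λ e → e := e :+ e :- e) ℚ.≃-refl (d ℚ.+ d) ⟩
      (d ℚ.+ d) ℚ.+ (d ℚ.+ d) ℚ.- (d ℚ.+ d)             <⟨ ℚ.+-monoˡ-< (ℚ.- (d ℚ.+ d)) 4d<δ ⟩
      δ ℚ.- (d ℚ.+ d)                                   ≤⟨ ℚ.+-monoˡ-≤ (ℚ.- (d ℚ.+ d)) h₁ ⟩
      (y ℚ.- x) ℚ.+ d ℚ.- (d ℚ.+ d)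
        ≃⟨ solve 2 (λ w d → w :+ d :- (d :+ d) := w :- d) ℚ.≃-refl (y ℚ.- x) d ⟩
      (y ℚ.- x) ℚ.- d                                   ≤⟨ ℚ.+-monoʳ-≤ (y ℚ.- x) (ℚ.neg-mono-≤ h₂) ⟩
      (y ℚ.- x) ℚ.- ((y ℚ.- z) ℚ.- u)
        ≃⟨ solve 4 (λ x y z u → (y :- x) :- ((y :- z) :- u) := u :- (x :- z)) ℚ.≃-refl x y z u ⟩
      u ℚ.- (x ℚ.- z)                                   ∎

  -- This turns a position skipped within distance 1 into one at distance less than 1, the core of
  -- the next operator.
  -‿<-≤-trans : ∀ {x y} z k → x Real.< y → y Real.- z Real.≤ Real.fromℕ k → x Real.- z Real.< Real.fromℕ k
  -‿<-≤-trans {x} {y} z k x<y h =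
    let δ , 0<δ , gap = <-gap {x} {y} x<y
        i , i-small   = 1/1+-archimedean 0<δ
        -- Each `odd` halves the error term, so `1/1+ n` is an eighth of `1/1+ i`. Four copies of
        -- the margin `1/1+ n ℚ.+ 1/1+ n` then amount to `1/1+ i`, which is below δ: two are lost to
        -- the hypotheses, and what remains exceeds the one that is required.
        n             = odd (odd (odd i))
    in n , <-by-quarters (1/1+ n ℚ.+ 1/1+ n) (seq x (odd n)) (seq y (odd n)) (seq z (odd n)) (mkℚᵘ (ℤ.+ k) 0)
      (ℚ.nonNegative⁻¹ (1/1+ n ℚ.+ 1/1+ n))
      (ℚ.≤-<-trans (eighth i) i-small)
      (ℚ.≤-trans (gap (odd n)) (ℚ.+-monoʳ-≤ (seq y (odd n) ℚ.- seq x (odd n)) (2/odd≤2/ n)))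
      (h n)
    where
    eighth : ∀ i → let e = 1/1+ odd (odd (odd i)) in (e ℚ.+ e ℚ.+ (e ℚ.+ e)) ℚ.+ (e ℚ.+ e ℚ.+ (e ℚ.+ e)) ℚ.≤ 1/1+ i
    eighth i = ℚ.≤-trans (ℚ.+-mono-≤ quarter quarter) (2/odd≤ i)
      where
      half    = 2/odd≤ (odd (odd i))
      quarter = ℚ.≤-trans (ℚ.+-mono-≤ half half) (2/odd≤ (odd i))

private
  natural : ℕ → ℚᵘ
  natural n = mkℚᵘ (ℤ.+ n) 0

  natural-difference : ∀ m n → natural (m ℕ.+ n) ℚ.- natural m ℚ.≃ natural n
  natural-difference m n = *≡* (lemma (ℤ.+ m) (ℤ.+ n))
    where
    lemma : ∀ m n → ((m ℤ.+ n) ℤ.* ℤ.+ 1 ℤ.+ (ℤ.- m) ℤ.* ℤ.+ 1) ℤ.* ℤ.+ 1 ≡ n ℤ.* ℤ.+ 1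
    lemma = ℤ-Ring.solve-∀

fromℕ-strict : ∀ m n → Real.fromℕ m Real.< Real.fromℕ (m ℕ.+ suc n)
-- Index 2 is the first one whose margin, 2/3, is less than 1.
fromℕ-strict m n = 2 , (begin-strict
  1/1+ 2 ℚ.+ 1/1+ 2                   <⟨ *<* (ℤ.+<+ (ℕ.m≤m+n 7 2)) ⟩
  natural 1                           ≤⟨ *≤* (ℤ.+≤+ (ℕ.s≤s ℕ.z≤n)) ⟩
  natural (suc n)                     ≃⟨ natural-difference m (suc n) ⟨
  natural (m ℕ.+ suc n) ℚ.- natural m ∎)
  where open ℚ.≤-Reasoning

fromℕ-difference : ∀ m n → Real.fromℕ (m ℕ.+ n) Real.- Real.fromℕ m Real.≃ Real.fromℕ n
fromℕ-difference m n =
    (λ i → bound (ℚ.p≃q⇒p-q≃0 (natural (m ℕ.+ n) ℚ.- natural m) (natural n) (natural-difference m n)))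
  , (λ i → bound (ℚ.p≃q⇒p-q≃0 (natural n) (natural (m ℕ.+ n) ℚ.- natural m) (ℚ.≃-sym (natural-difference m n))))
  where
  bound : ∀ {q i} → q ℚ.≃ 0ℚᵘ → q ℚ.≤ 1/1+ i ℚ.+ 1/1+ i
  bound {q} {i} h = ℚ.≤-trans (ℚ.≤-reflexive h) (ℚ.nonNegative⁻¹ (1/1+ i ℚ.+ 1/1+ i))

fromℕ-difference≮1 : ∀ m n → ¬ (Real.fromℕ (m ℕ.+ suc n) Real.- Real.fromℕ m Real.< Real.fromℕ 1)
fromℕ-difference≮1 m n (i , p) = ℚ.<-irrefl (ℚ.≃-refl {0ℚᵘ}) (begin-strict
  0ℚᵘ                                     ≤⟨ ℚ.nonNegative⁻¹ (1/1+ i ℚ.+ 1/1+ i) ⟩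
  1/1+ i ℚ.+ 1/1+ i                       <⟨ p ⟩
  natural 1 ℚ.- (natural (m ℕ.+ suc n) ℚ.- natural m)
    ≃⟨ ℚ.+-congʳ (natural 1) (ℚ.-‿cong (natural-difference m (suc n))) ⟩
  natural 1 ℚ.- natural (suc n)
    ≤⟨ ℚ.p≤q⇒p-q≤0 {natural 1} {natural (suc n)} (*≤* (ℤ.+≤+ (ℕ.s≤s ℕ.z≤n))) ⟩
  0ℚᵘ                                     ∎)
  where open ℚ.≤-Reasoning

-- Unique decoding

private
  variable
    ys zs : List Token

-- The arbitrary remainders `ys` and `zs` make this a statement about prefix codes, which can be
-- chained along the concatenations of Polish notation.
encodeUnary-cancel : ∀ m n → encodeUnary m ++ ys ≡ encodeUnary n ++ zs → m ≡ n × ys ≡ zs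
encodeUnary-cancel zero    zero    refl = refl , refl
encodeUnary-cancel zero    (suc n) ()
encodeUnary-cancel (suc m) zero    ()
encodeUnary-cancel (suc m) (suc n) e with encodeUnary-cancel m n (∷-injectiveʳ e)
... | refl , ys≡zs = refl , ys≡zs

encodeBits-cancel : ∀ (bs cs : List Bit) →
  (map encodeBit bs ++ [ stop ]) ++ ys ≡ (map encodeBit cs ++ [ stop ]) ++ zs → bs ≡ cs × ys ≡ zs
encodeBits-cancel []                []                refl = refl , refl
encodeBits-cancel []                (zero ∷ cs)       ()
encodeBits-cancel []                (suc zero ∷ cs)   ()
encodeBits-cancel (zero ∷ bs)       []                ()
encodeBits-cancel (suc zero ∷ bs)   []                ()
encodeBits-cancel (zero ∷ bs)       (suc zero ∷ cs)   ()
encodeBits-cancel (suc zero ∷ bs)   (zero ∷ cs)       ()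
encodeBits-cancel (zero ∷ bs)       (zero ∷ cs)       e with encodeBits-cancel bs cs (∷-injectiveʳ e)
... | refl , ys≡zs = refl , ys≡zs
encodeBits-cancel (suc zero ∷ bs)   (suc zero ∷ cs)   e with encodeBits-cancel bs cs (∷-injectiveʳ e)
... | refl , ys≡zs = refl , ys≡zs

-- Injectivity comes from `toDigits` itself, whose result includes a proof that the digits evaluate
-- to the given number.
encodeBinary-cancel : ∀ m n → encodeBinary m ++ ys ≡ encodeBinary n ++ zs → m ≡ n × ys ≡ zs
encodeBinary-cancel m n e with encodeBits-cancel (proj₁ (toDigits 2 m)) (proj₁ (toDigits 2 n)) e
... | bs≡cs , ys≡zs =
  trans (sym (proj₂ (toDigits 2 m))) (trans (cong fromDigits bs≡cs) (proj₂ (toDigits 2 n))) , ys≡zs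

encodeBracket-injective : ∀ {b c} → encodeBracket b ≡ encodeBracket c → b ≡ c
encodeBracket-injective {closed} {closed} _ = refl
encodeBracket-injective {open′}  {open′}  _ = refl

encodeBracket≢infinity : ∀ {b} → encodeBracket b ≢ infinity
encodeBracket≢infinity {closed} ()
encodeBracket≢infinity {open′} ()

encodeInterval-cancel : ∀ I J → encodeInterval I ++ ys ≡ encodeInterval J ++ zs → I ≡ J × ys ≡ zs
encodeInterval-cancel {ys} {zs} I J e = go I J e
  where
  split : ∀ n {x xs t} → encodeBinary n ++ x ∷ xs ++ t ≡ (encodeBinary n ++ x ∷ xs) ++ t
  split n {x} {xs} {t} = sym (++-assoc (encodeBinary n) (x ∷ xs) t)

  go : ∀ I J → encodeInterval I ++ ys ≡ encodeInterval J ++ zs → I ≡ J × ys ≡ zs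
  go (bounded b l c u _) (bounded b′ l′ c′ u′ _) e
    with b≡b′ , e₁ ← ∷-injective e
    with refl ← encodeBracket-injective b≡b′
    with refl , e₂ ← encodeBinary-cancel l l′ (trans (split l) (trans e₁ (sym (split l′))))
    with c≡c′ , e₃ ← ∷-injective e₂
    with refl ← encodeBracket-injective c≡c′
    with refl , ys≡zs ← encodeBinary-cancel u u′ e₃ = refl , ys≡zs
  -- The two kinds of intervals are told apart by the token after the left endpoint: a bracket or
  -- `infinity`.
  go (bounded b l c u _) (unbounded b′ l′) e
    with _ , e₂ ← encodeBinary-cancel l l′ (trans (split l) (trans (∷-injectiveʳ e) (sym (split l′))))
    with () ← encodeBracket≢infinity (proj₁ (∷-injective e₂))
  go (unbounded b l) (bounded b′ l′ c′ u′ _) e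
    with _ , e₂ ← encodeBinary-cancel l l′ (trans (split l) (trans (∷-injectiveʳ e) (sym (split l′))))
    with () ← encodeBracket≢infinity (sym (proj₁ (∷-injective e₂)))
  go (unbounded b l) (unbounded b′ l′) e
    with b≡b′ , e₁ ← ∷-injective e
    with refl ← encodeBracket-injective b≡b′
    with refl , e₂ ← encodeBinary-cancel l l′ (trans (split l) (trans e₁ (sym (split l′)))) =
    refl , ∷-injectiveʳ e₂

encodeFormula-cancel : ∀ {k} (φ ψ : Formula k) →
  encodeFormula φ ++ ys ≡ encodeFormula ψ ++ zs → φ ≡ ψ × ys ≡ zs
encodeFormula-cancel (atom a) (atom b) e
  with a≡b , ys≡zs ← encodeUnary-cancel (toℕ a) (toℕ b) e
  with refl ← toℕ-injective a≡b = refl , ys≡zs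
encodeFormula-cancel {ys} {zs} (φ ∨′ φ′) (ψ ∨′ ψ′) e
  with refl , e′ ← encodeFormula-cancel φ ψ
    (trans (sym (++-assoc (encodeFormula φ) _ ys)) (trans (∷-injectiveʳ e) (++-assoc (encodeFormula ψ) _ zs)))
  with refl , ys≡zs ← encodeFormula-cancel φ′ ψ′ e′ = refl , ys≡zs
encodeFormula-cancel (¬′ φ) (¬′ ψ) e
  with refl , ys≡zs ← encodeFormula-cancel φ ψ (∷-injectiveʳ e) = refl , ys≡zs
encodeFormula-cancel {ys} {zs} (F I φ) (F J ψ) e
  with refl , e′ ← encodeInterval-cancel I J
    (trans (sym (++-assoc (encodeInterval I) _ ys)) (trans (∷-injectiveʳ e) (++-assoc (encodeInterval J) _ zs)))
  with refl , ys≡zs ← encodeFormula-cancel φ ψ e′ = refl , ys≡zs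
encodeFormula-cancel {ys} {zs} (P I φ) (P J ψ) e
  with refl , e′ ← encodeInterval-cancel I J
    (trans (sym (++-assoc (encodeInterval I) _ ys)) (trans (∷-injectiveʳ e) (++-assoc (encodeInterval J) _ zs)))
  with refl , ys≡zs ← encodeFormula-cancel φ ψ e′ = refl , ys≡zs
encodeFormula-cancel (atom zero) (_ ∨′ _) ()
encodeFormula-cancel (atom (suc _)) (_ ∨′ _) ()
encodeFormula-cancel (atom zero) (¬′ _) ()
encodeFormula-cancel (atom (suc _)) (¬′ _) ()
encodeFormula-cancel (atom zero) (F _ _) ()
encodeFormula-cancel (atom (suc _)) (F _ _) ()
encodeFormula-cancel (atom zero) (P _ _) ()
encodeFormula-cancel (atom (suc _)) (P _ _) ()
encodeFormula-cancel (_ ∨′ _) (atom zero) ()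
encodeFormula-cancel (_ ∨′ _) (atom (suc _)) ()
encodeFormula-cancel (_ ∨′ _) (¬′ _) ()
encodeFormula-cancel (_ ∨′ _) (F _ _) ()
encodeFormula-cancel (_ ∨′ _) (P _ _) ()
encodeFormula-cancel (¬′ _) (atom zero) ()
encodeFormula-cancel (¬′ _) (atom (suc _)) ()
encodeFormula-cancel (¬′ _) (_ ∨′ _) ()
encodeFormula-cancel (¬′ _) (F _ _) ()
encodeFormula-cancel (¬′ _) (P _ _) ()
encodeFormula-cancel (F _ _) (atom zero) ()
encodeFormula-cancel (F _ _) (atom (suc _)) ()
encodeFormula-cancel (F _ _) (_ ∨′ _) ()
encodeFormula-cancel (F _ _) (¬′ _) ()
encodeFormula-cancel (F _ _) (P _ _) ()
encodeFormula-cancel (P _ _) (atom zero) ()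
encodeFormula-cancel (P _ _) (atom (suc _)) ()
encodeFormula-cancel (P _ _) (_ ∨′ _) ()
encodeFormula-cancel (P _ _) (¬′ _) ()
encodeFormula-cancel (P _ _) (F _ _) ()

-- Used in the direction from satisfiability to acceptance: the formula found behind the printed
-- string must be the one constructed from the input.
encode-injective : ∀ {k l} {φ : Formula k} {ψ : Formula l} → encode k φ ≡ encode l ψ →
  _≡_ {A = Σ[ k ∈ ℕ ] Formula k} (k , φ) (l , ψ)
encode-injective {k} {l} {φ} {ψ} e
  with refl , e′ ← encodeUnary-cancel k l e
  with refl , _ ← encodeFormula-cancel φ ψ (cong (_++ []) e′) = refl

-- Printing programs and the machines that run them

⊎-finite : ∀ {X Y : Set} → Finite X → Finite Y → Finite (X ⊎ Y)
⊎-finite (m , X↔m) (n , Y↔n) = m + n , ↔-trans (X↔m ⊎-↔ Y↔n) (↔-sym +↔⊎)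

inputCells : ∀ {A W : Set} → List A → List (Maybe (A ⊎ W))
inputCells = map (λ a → just (inj₁ a))

module _ {A B : Set} where

  private
    Cell : Set
    Cell = Maybe (A ⊎ ⊥)

    variable
      n : ℕ

  -- Loop programs printing a string over B.  All n tapes hold the input; a loop
  -- scans the first tape, and its body has the other ones at its disposal.
  data Program : ℕ → Set where
    emit : List B → Program n
    _⨾_  : Program n → Program n → Program n
    for  : (A → List B) → Program n → Program (suc n)

  infixr 5 _⨾_

  printed : Program n → List A → List B
  printed (emit s)  w = s
  printed (p ⨾ q)   w = printed p w ++ printed q w
  printed (for g p) w = concatMap (λ a → g a ++ printed p w) w

  -- For each letter a loop takes one `advance`, one `test` and a run of its body. Leaving it takes
  -- one further `advance` and `test`, which meet the blank, and n + 1 steps of `rewind`.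
  cost : Program n → ℕ → ℕ
  cost (emit s)  n = 1
  cost (p ⨾ q)   n = cost p n + cost q n
  cost (for g p) n = n * (2 + cost p n) + (3 + n)

  Control : Program n → Set
  Control (emit s)  = ⊤
  Control (p ⨾ q)   = Control p ⊎ Control q
  Control (for g p) = Fin 3 ⊎ Control p

  pattern advance = inj₁ zero
  pattern test    = inj₁ (suc zero)
  pattern rewind  = inj₁ (suc (suc zero))
  pattern body c  = inj₂ c

  Control-finite : (p : Program n) → Finite (Control p)
  Control-finite (emit s)  = 1 , ↔-sym 1↔⊤
  Control-finite (p ⨾ q)   = ⊎-finite (Control-finite p) (Control-finite q)
  Control-finite (for g p) = ⊎-finite (3 , ↔-refl) (Control-finite p)

  start : (p : Program n) → Control p
  start (emit s)  = tt
  start (p ⨾ q)   = inj₁ (start p)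
  start (for g p) = advance

  Acts : ℕ → Set
  Acts = Vec (Cell × Move)

  keep : Vec Cell n → Acts n
  keep = Vec.map (_, stay)

  enact : Vec (Tape Cell) n → Acts n → Vec (Tape Cell) n
  enact = zipWith (writeMove nothing)

  enact-keep : (ts : Vec (Tape Cell) n) → enact ts (keep (Vec.map Tape.head ts)) ≡ ts
  enact-keep []       = refl
  enact-keep (t ∷ ts) = cong (t ∷_) (enact-keep ts)

  -- The successor is nothing when the program exits.
  transit : (p : Program n) → Control p → Vec Cell n → Maybe (Control p) × Acts n × List B
  transit (emit s)  _        h = nothing , keep h , s
  transit (p ⨾ q)   (inj₁ c) h =
    let r , as , o = transit p c h in just (maybe′ inj₁ (inj₂ (start q)) r) , as , o
  transit (p ⨾ q)   (inj₂ c) h = let r , as , o = transit q c h in Maybe.map inj₂ r , as , o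
  transit (for g p) advance  (x ∷ h) = just test , (x , right) ∷ keep h , []
  transit (for g p) test     (just (inj₁ a) ∷ h) = just (body (start p)) , keep (just (inj₁ a) ∷ h) , g a
  transit (for g p) test     (nothing ∷ h)       = just rewind , (nothing , left) ∷ keep h , []
  transit (for g p) rewind   (just x ∷ h)        = just rewind , (just x , left) ∷ keep h , []
  transit (for g p) rewind   (nothing ∷ h)       = nothing , keep (nothing ∷ h) , []
  transit (for g p) (body c) (x ∷ h) =
    let r , as , o = transit p c h in just (maybe′ body advance r) , (x , stay) ∷ as , o

  data Exec (p : Program n) (c : Control p) (ts : Vec (Tape Cell) n) :
      ℕ → List B → Vec (Tape Cell) n → Set where
    exit : ∀ {as o ts′} → transit p c (Vec.map Tape.head ts) ≡ (nothing , as , o) → enact ts as ≡ ts′ →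
           Exec p c ts 1 o ts′
    more : ∀ {c′ as o ts′ k o′ ts″} → transit p c (Vec.map Tape.head ts) ≡ (just c′ , as , o) →
           enact ts as ≡ ts′ → Exec p c′ ts′ k o′ ts″ → Exec p c ts (suc k) (o ++ o′) ts″

  private
    variable
      k l : ℕ
      o o′ : List B
      ts ts′ ts″ : Vec (Tape Cell) n

  Exec-resp : ∀ {p : Program n} {c} → k ≡ l → o ≡ o′ → ts′ ≡ ts″ → Exec p c ts k o ts′ → Exec p c ts l o′ ts″
  Exec-resp refl refl refl x = x

  Exec-inj₂ : ∀ {p q : Program n} {c} → Exec q c ts k o ts′ → Exec (p ⨾ q) (inj₂ c) ts k o ts′
  Exec-inj₂ (exit e f)   = exit (cong (λ (r , as , o) → Maybe.map inj₂ r , as , o) e) f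
  Exec-inj₂ (more e f x) = more (cong (λ (r , as , o) → Maybe.map inj₂ r , as , o) e) f (Exec-inj₂ x)

  -- The exit step of p becomes the step that enters q, so the costs add up without overhead.
  Exec-⨾ : ∀ {p q : Program n} {c} → Exec p c ts k o ts′ → Exec q (start q) ts′ l o′ ts″ →
    Exec (p ⨾ q) (inj₁ c) ts (k + l) (o ++ o′) ts″
  Exec-⨾ {q = q} (exit e f) y =
    more (cong (λ (r , as , o) → just (maybe′ inj₁ (inj₂ (start q)) r) , as , o) e) f (Exec-inj₂ y)
  Exec-⨾ {q = q} {c = c} (more {o = o} {o′ = o′} e f x) y =
    Exec-resp refl (sym (++-assoc o o′ _)) refl
      (more (cong (λ (r , as , o) → just (maybe′ inj₁ (inj₂ (start q)) r) , as , o) e) f (Exec-⨾ x y))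

  Exec-body : ∀ {g} {p : Program n} {c t} → Exec p c ts k o ts′ → Exec (for g p) advance (t ∷ ts′) l o′ ts″ →
    Exec (for g p) (body c) (t ∷ ts) (k + l) (o ++ o′) ts″
  Exec-body {t = t} (exit e f) y =
    more (cong (λ (r , as , o) → just (maybe′ body advance r) , (Tape.head t , stay) ∷ as , o) e) (cong (t ∷_) f) y
  Exec-body {c = c} {t = t} (more {o = o} {o′ = o′} e f x) y =
    Exec-resp refl (sym (++-assoc o o′ _)) refl
      (more (cong (λ (r , as , o) → just (maybe′ body advance r) , (Tape.head t , stay) ∷ as , o) e) (cong (t ∷_) f)
        (Exec-body x y))

  inputCells-ʳ++ : ∀ v {w} {rs : List Cell} →
    inputCells (v ʳ++ w) ++ rs ≡ inputCells v ʳ++ (inputCells w ++ rs)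
  inputCells-ʳ++ []      = refl
  inputCells-ʳ++ (a ∷ v) = inputCells-ʳ++ v

  -- The head is on the last of the letters read, given in reverse, or else on
  -- the blank left of the input.
  scanned : List A → List Cell → Tape Cell
  scanned []      rs = tape [] nothing rs
  scanned (a ∷ v) rs = tape (inputCells v ++ [ nothing ]) (just (inj₁ a)) rs

  -- The blank right of the input is included because a scan visits it and visited cells stay
  -- represented. Thus a scan ends with literally the tape it started from.
  home : List A → Tape Cell
  home w = scanned [] (inputCells w ++ [ nothing ])

  scanned-right : ∀ v {r rs} →
    writeMove nothing (scanned v (r ∷ rs)) (Tape.head (scanned v (r ∷ rs)) , right) ≡ tape (inputCells v ++ [ nothing ]) r rs
  scanned-right []      = refl
  scanned-right (a ∷ v) = refl

  scanned-left : ∀ v {x rs} →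
    writeMove nothing (tape (inputCells v ++ [ nothing ]) x rs) (x , left) ≡ scanned v (x ∷ rs)
  scanned-left []      = refl
  scanned-left (a ∷ v) = refl

  Exec-rewind : ∀ {g} {p : Program n} v {rs ts} →
    Exec (for g p) rewind (scanned v rs ∷ ts) (suc (length v)) [] (scanned [] (inputCells v ʳ++ rs) ∷ ts)
  Exec-rewind []      {rs} {ts} = exit refl (cong (_ ∷_) (enact-keep ts))
  Exec-rewind (a ∷ v) {rs} {ts} = more refl (cong₂ _∷_ (scanned-left v) (enact-keep ts)) (Exec-rewind v)

  -- Every program returns all its tapes to `home`; this invariant allows a loop to run its body
  -- again for the next letter.
  Exec-program : (p : Program n) (w : List A) →
    Exec p (start p) (replicate n (home w)) (cost p (length w)) (printed p w) (replicate n (home w))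
  Exec-program (emit s) w = exit refl (enact-keep _)
  Exec-program (p ⨾ q)  w = Exec-⨾ (Exec-program p w) (Exec-program q w)
  Exec-program {suc n} (for g p) w = scan [] w refl
    where
    hs = replicate n (home w)

    scan : ∀ v u → v ʳ++ u ≡ w →
      Exec (for g p) advance (scanned v (inputCells u ++ [ nothing ]) ∷ hs)
        (length u * (2 + cost p (length w)) + (3 + length w))
        (concatMap (λ a → g a ++ printed p w) u) (home w ∷ hs)
    scan v [] refl =
      more refl (cong₂ _∷_ (scanned-right v) (enact-keep hs))
        (more refl (cong₂ _∷_ (scanned-left v) (enact-keep hs))
          (Exec-resp (cong suc (sym (trans (length-ʳ++ v) (+-identityʳ _)))) refl
            (cong (λ rs → tape [] nothing rs ∷ hs) (sym (inputCells-ʳ++ v)))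
            (Exec-rewind v)))
    scan v (a ∷ u) e =
      Exec-resp (cong (2 +_) (sym (+-assoc (cost p (length w)) _ _))) (sym (++-assoc (g a) _ _)) refl
        (more refl (cong₂ _∷_ (scanned-right v) (enact-keep hs))
          (more refl (cong (_ ∷_) (enact-keep hs))
            (Exec-body (Exec-program p w) (scan (a ∷ v) u e))))

  module _ {d : ℕ} (p : Program (suc d)) where

    -- Before the program starts, the input is copied from the first tape to all
    -- others, and all heads move to the blank left of the input.
    private
      Phase : Set
      Phase = Fin 3 ⊎ Control p

      pattern copying    = inj₁ zero
      pattern rewinding  = inj₁ (suc zero)
      pattern done       = inj₁ (suc (suc zero))
      pattern running c  = inj₂ c

      run : Maybe (Control p) × Acts (suc d) × List B → Phase × Acts (suc d) × List B
      run (r , as , o) = maybe′ inj₂ done r , as , o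

      next-phase : Phase → Vec Cell (suc d) → Maybe (Phase × Acts (suc d) × List B)
      next-phase copying     (just x ∷ h)  = just (copying , replicate _ (just x , right) , [])
      next-phase copying     (nothing ∷ h) = just (rewinding , replicate _ (nothing , left) , [])
      next-phase rewinding   (just x ∷ h)  = just (rewinding , replicate _ (just x , left) , [])
      next-phase rewinding   (nothing ∷ h) = just (running (start p) , keep (nothing ∷ h) , [])
      next-phase done        h             = nothing
      next-phase (running c) h             = just (run (transit p c h))

    printer : Machine A B
    printer = record
      { State        = Phase
      ; Work         = ⊥
      ; finiteState  = ⊎-finite (3 , ↔-refl) (Control-finite p)
      ; finiteWork   = 0 , ↔-sym 0↔⊥
      ; extraTapes   = d
      ; initialState = copying
      ; accepting    = λ _ → false
      ; transition   = next-phase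
      }

    private
      Runs : Phase → Vec (Tape Cell) (suc d) → ℕ → List B → Set
      Runs c ts k o = Σ[ r ∈ Run printer (c , ts) ] (Defs.time r ≡ k × output r ≡ o)

      next-just : ∀ {c c′ as} → next-phase c (Vec.map Tape.head ts) ≡ just (c′ , as , o) →
        next printer (c , ts) ≡ just ((c′ , enact ts as) , o)
      next-just e rewrite e = refl

      Runs-step : ∀ {c c′ as} → next-phase c (Vec.map Tape.head ts) ≡ just (c′ , as , o) → enact ts as ≡ ts′ →
        Runs c′ ts′ k o′ → Runs c ts (suc k) (o ++ o′)
      Runs-step e refl (r , refl , refl) = step (next-just e) r , refl , refl

      Runs-resp : ∀ {c} → ts ≡ ts′ → k ≡ l → Runs c ts k o → Runs c ts′ l o
      Runs-resp refl refl r = r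

      Runs-Exec : ∀ {c} → Exec p c ts k o ts′ → Runs (running c) ts k o
      Runs-Exec {o = o} (exit e f) with Runs-step (cong (just ∘ run) e) f (halt refl , refl , refl)
      ... | r , t , w = r , t , trans w (++-identityʳ o)
      Runs-Exec (more e f x) = Runs-step (cong (just ∘ run) e) f (Runs-Exec x)

      -- Unlike in `scanned`, the blank left of the input is absent from the left stack, since the
      -- first rewinding has not visited it yet.
      rewound : List A → List Cell → Tape Cell
      rewound []      rs = tape [] nothing rs
      rewound (a ∷ v) rs = tape (inputCells v) (just (inj₁ a)) rs

      rewound-left : ∀ v {x rs} →
        writeMove nothing (tape (inputCells v) x rs) (x , left) ≡ rewound v (x ∷ rs)
      rewound-left []      = refl
      rewound-left (a ∷ v) = refl

      all-left : ∀ v {x rs} → enact (replicate (suc d) (tape (inputCells v) x rs)) (replicate _ (x , left)) ≡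
        replicate _ (rewound v (x ∷ rs))
      all-left v = trans (zipWith-replicate _ _ _) (cong (replicate _) (rewound-left v))

      Runs-rewinding : ∀ v w u → v ʳ++ u ≡ w →
        Runs rewinding (replicate _ (rewound v (inputCells u ++ [ nothing ])))
          (suc (length v) + cost p (length w)) (printed p w)
      Runs-rewinding []      w u refl = Runs-step refl (enact-keep _) (Runs-Exec (Exec-program p w))
      Runs-rewinding (a ∷ v) w u e    = Runs-step refl (all-left v) (Runs-rewinding v w (a ∷ u) e)

      unread : List A → List A → Tape Cell
      unread v []      = tape (inputCells v) nothing []
      unread v (a ∷ u) = tape (inputCells v) (just (inj₁ a)) (inputCells u)

      unread-right : ∀ v a u →
        writeMove nothing (unread v (a ∷ u)) (just (inj₁ a) , right) ≡ unread (a ∷ v) u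
      unread-right v a []      = refl
      unread-right v a (b ∷ u) = refl

      Runs-copying : ∀ v u w → v ʳ++ u ≡ w →
        Runs copying (unread v u ∷ replicate d (tape (inputCells v) nothing []))
          (length u + (2 + (length w + cost p (length w)))) (printed p w)
      Runs-copying v [] w refl = Runs-step refl (all-left v)
        (Runs-resp refl (cong (λ n → suc n + cost p (length w)) (sym (trans (length-ʳ++ v) (+-identityʳ _))))
          (Runs-rewinding v w [] refl))
      Runs-copying v (a ∷ u) w e =
        Runs-step refl (cong₂ _∷_ (unread-right v a u) (zipWith-replicate _ _ _)) (Runs-copying (a ∷ v) u w e)

      unread-all : ∀ w → fromList nothing (inputCells w) ≡ unread [] w
      unread-all []      = refl
      unread-all (a ∷ w) = refl

    printer-runs : ∀ w → Σ[ r ∈ Run printer (initial printer w) ]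
      (Defs.time r ≡ length w + (2 + (length w + cost p (length w))) × output r ≡ printed p w)
    printer-runs w = Runs-resp (cong (_∷ _) (sym (unread-all w))) refl (Runs-copying [] w w refl)

-- Polynomial bounds

-- The base suc n makes the bound monotone in d, even for n = 0.
PolynomiallyBounded : (ℕ → ℕ) → Set
PolynomiallyBounded f = ∃[ c ] ∃[ d ] ∀ n → f n ≤ c * suc n ^ d

constant-bounded : ∀ k → PolynomiallyBounded (λ _ → k)
constant-bounded k = k , 0 , λ n → ≤-reflexive (sym (*-identityʳ k))

identity-bounded : PolynomiallyBounded (λ n → n)
identity-bounded = 1 , 1 , λ n →
  ≤-trans (n≤1+n n) (≤-reflexive (sym (trans (*-identityˡ _) (*-identityʳ _))))

module _ {f g : ℕ → ℕ} where

  open ≤-Reasoning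

  +-bounded : PolynomiallyBounded f → PolynomiallyBounded g → PolynomiallyBounded (λ n → f n + g n)
  +-bounded (c , d , f≤) (c′ , d′ , g≤) = c + c′ , d + d′ , λ n → begin
    f n + g n                                        ≤⟨ +-mono-≤ (f≤ n) (g≤ n) ⟩
    c * suc n ^ d + c′ * suc n ^ d′                  ≤⟨ +-mono-≤ (*-monoʳ-≤ c (^-monoʳ-≤ (suc n) (m≤m+n d d′)))
                                                                 (*-monoʳ-≤ c′ (^-monoʳ-≤ (suc n) (m≤n+m d′ d))) ⟩
    c * suc n ^ (d + d′) + c′ * suc n ^ (d + d′)     ≡⟨ *-distribʳ-+ (suc n ^ (d + d′)) c c′ ⟨
    (c + c′) * suc n ^ (d + d′)                      ∎

  *-bounded : PolynomiallyBounded f → PolynomiallyBounded g → PolynomiallyBounded (λ n → f n * g n)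
  *-bounded (c , d , f≤) (c′ , d′ , g≤) = c * c′ , d + d′ , λ n → begin
    f n * g n                                  ≤⟨ *-mono-≤ (f≤ n) (g≤ n) ⟩
    (c * suc n ^ d) * (c′ * suc n ^ d′)        ≡⟨ [m*n]*[o*p]≡[m*o]*[n*p] c (suc n ^ d) c′ (suc n ^ d′) ⟩
    (c * c′) * (suc n ^ d * suc n ^ d′)        ≡⟨ cong (c * c′ *_) (^-distribˡ-+-* (suc n) d d′) ⟨
    (c * c′) * suc n ^ (d + d′)                ∎

*-distribʳ-^ : ∀ m n d → (m * n) ^ d ≡ m ^ d * n ^ d
*-distribʳ-^ m n zero    = refl
*-distribʳ-^ m n (suc d) =
  trans (cong (m * n *_) (*-distribʳ-^ m n d)) ([m*n]*[o*p]≡[m*o]*[n*p] m n (m ^ d) (n ^ d))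

-- For positive n, n + 1 is at most 2n, which costs a factor of 2^d. For n = 0 the additive constant
-- of `polynomial` takes over.
bounded⇒≤polynomial : ∀ {f} → PolynomiallyBounded f → ∃[ c ] ∃[ d ] ∀ n → f n ≤ polynomial c d n
bounded⇒≤polynomial {f} (c , d , f≤) = c * 2 ^ d , d , λ n → ≤-trans (f≤ n) (bound n)
  where
  open ≤-Reasoning
  bound : ∀ n → c * suc n ^ d ≤ polynomial (c * 2 ^ d) d n
  bound zero = begin
    c * 1 ^ d                          ≤⟨ *-monoʳ-≤ c (^-monoˡ-≤ d (s≤s z≤n)) ⟩
    c * 2 ^ d                          ≤⟨ m≤n+m _ _ ⟩
    polynomial (c * 2 ^ d) d 0         ∎
  bound n@(suc m) = begin
    c * suc n ^ d                      ≤⟨ *-monoʳ-≤ c (^-monoˡ-≤ d (s≤s (m≤n+m n m))) ⟩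
    c * (n + n) ^ d                    ≡⟨ cong (λ k → c * (n + k) ^ d) (+-identityʳ n) ⟨
    c * (2 * n) ^ d                    ≡⟨ cong (c *_) (*-distribʳ-^ 2 n d) ⟩
    c * (2 ^ d * n ^ d)                ≡⟨ *-assoc c _ _ ⟨
    c * 2 ^ d * n ^ d                  ≤⟨ m≤m+n _ _ ⟩
    polynomial (c * 2 ^ d) d n         ∎

module _ {A B : Set} where

  cost-bounded : ∀ {n} (p : Program {A} {B} n) → PolynomiallyBounded (cost p)
  cost-bounded (emit s)  = constant-bounded 1
  cost-bounded (p ⨾ q)   = +-bounded (cost-bounded p) (cost-bounded q)
  cost-bounded (for g p) = +-bounded
    (*-bounded identity-bounded (+-bounded (constant-bounded 2) (cost-bounded p)))
    (+-bounded (constant-bounded 3) identity-bounded)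

  printed-polynomialTime : ∀ {d} (p : Program {A} {B} (suc d)) → PolynomialTime (printed p)
  printed-polynomialTime p with bounded⇒≤polynomial (+-bounded identity-bounded
    (+-bounded (constant-bounded 2) (+-bounded identity-bounded (cost-bounded p))))
  ... | c , d , bound = printer p , c , d , λ w → let r , time≡ , output≡ = printer-runs p w in
    r , ≤-trans (≤-reflexive time≡) (bound (length w)) , output≡

-- Runs of a machine as recurrent sequences of letters

private
  variable
    V : Set

cong₄ : ∀ {V W : Set} (f : V → V → V → V → W) {a a′ b b′ c c′ e e′} →
  a ≡ a′ → b ≡ b′ → c ≡ c′ → e ≡ e′ → f a b c e ≡ f a′ b′ c′ e′
cong₄ f refl refl refl refl = refl

append : ℕ → (ℕ → V) → (ℕ → V) → ℕ → V
append zero    g h j       = h j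
append (suc m) g h zero    = g zero
append (suc m) g h (suc j) = append m (g ∘ suc) h j

append-< : ∀ {m} (g h : ℕ → V) {j} → j < m → append m g h j ≡ g j
append-< {m = suc m} g h {zero}  _         = refl
append-< {m = suc m} g h {suc j} (s≤s j<m) = append-< (g ∘ suc) h j<m

append-+ : ∀ m (g h : ℕ → V) j → append m g h (m + j) ≡ h j
append-+ zero    g h j = refl
append-+ (suc m) g h j = append-+ m (g ∘ suc) h j

append-all : ∀ m (Q : V → Set) {g h : ℕ → V} →
  (∀ j → Q (g j)) → (∀ j → Q (h j)) → ∀ j → Q (append m g h j)
append-all zero    Q pg ph j       = ph j
append-all (suc m) Q pg ph zero    = pg zero
append-all (suc m) Q pg ph (suc j) = append-all m Q (pg ∘ suc) ph j

Prefix : List V → (ℕ → V) → Set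
Prefix []       s = ⊤
Prefix (x ∷ xs) s = s 0 ≡ x × Prefix xs (s ∘ suc)

Prefix-append : ∀ xs {m} {g h : ℕ → V} → length xs ≤ m → Prefix xs g → Prefix xs (append m g h)
Prefix-append []       _         _        = tt
Prefix-append (x ∷ xs) (s≤s len) (e , es) = e , Prefix-append xs len es

nth : List (Maybe V) → ℕ → Maybe V
nth []       j       = nothing
nth (x ∷ xs) zero    = x
nth (x ∷ xs) (suc j) = nth xs j

nth-beyond : ∀ (xs : List (Maybe V)) {j} → length xs ≤ j → nth xs j ≡ nothing
nth-beyond []       _         = refl
nth-beyond (x ∷ xs) (s≤s len) = nth-beyond xs len

tabulate-≡ : ∀ {n} {h : Fin n → V} {v : Vec V n} → (∀ i → h i ≡ lookup v i) → tabulate h ≡ v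
tabulate-≡ {v = v} p = trans (tabulate-cong p) (tabulate∘lookup v)

-- A tape is viewed as two stacks that meet at the head: column j holds the
-- j-th cell to the left of the head and the j-th cell from the head on.
module Columns {S : Set} where

  Column : Set
  Column = Maybe S × Maybe S

  column : ℕ → Tape (Maybe S) → Column
  column j (tape ls h rs) = nth ls j , nth (h ∷ rs) j

  -- After a left move the symbol just written lies in column 1, while the old column 0 still shows
  -- the symbol it replaced. The left neighbour of column 1 is corrected by this function before
  -- `laterColumn` reads it.
  written : Maybe S × Move → Column → Column
  written (s , _) (l , r) = l , s

  firstColumn : Maybe S × Move → Column → Column → Column
  firstColumn (s , stay)  (l , _) _        = l , s
  firstColumn (s , left)  (l , _) (l′ , _) = l′ , l
  firstColumn (s , right) (l , _) (_ , r′) = s , r′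

  laterColumn : Maybe S × Move → Column → Column → Column → Column
  laterColumn (s , stay)  _       b _        = b
  laterColumn (s , left)  (_ , r) _ (l′ , _) = l′ , r
  laterColumn (s , right) (l , _) _ (_ , r′) = l , r′

  private
    after : Maybe S × Move → Tape (Maybe S) → Tape (Maybe S)
    after a t = writeMove nothing t a

  column-first : ∀ a t → firstColumn a (column 0 t) (column 1 t) ≡ column 0 (after a t)
  column-first (s , stay)  (tape ls       h rs)       = refl
  column-first (s , left)  (tape []       h rs)       = refl
  column-first (s , left)  (tape (l ∷ ls) h rs)       = refl
  column-first (s , right) (tape ls       h [])       = refl
  column-first (s , right) (tape ls       h (r ∷ rs)) = refl

  column-second : ∀ a t →
    laterColumn a (written a (column 0 t)) (column 1 t) (column 2 t) ≡ column 1 (after a t)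
  column-second (s , stay)  (tape ls       h rs)       = refl
  column-second (s , left)  (tape []       h rs)       = refl
  column-second (s , left)  (tape (l ∷ ls) h rs)       = refl
  column-second (s , right) (tape ls       h [])       = refl
  column-second (s , right) (tape ls       h (r ∷ rs)) = refl

  column-later : ∀ a t j →
    laterColumn a (column (1 + j) t) (column (2 + j) t) (column (3 + j) t) ≡ column (2 + j) (after a t)
  column-later (s , stay)  (tape ls       h rs)       j = refl
  column-later (s , left)  (tape []       h rs)       j = refl
  column-later (s , left)  (tape (l ∷ ls) h rs)       j = refl
  column-later (s , right) (tape ls       h [])       j = refl
  column-later (s , right) (tape ls       h (r ∷ rs)) j = refl

  column-beyond : ∀ {j} t → size t ≤ j → column j t ≡ (nothing , nothing)
  column-beyond (tape ls h rs) fits = cong₂ _,_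
    (nth-beyond ls (m+n≤o⇒m≤o (length ls) fits))
    (nth-beyond (h ∷ rs) (m+n≤o⇒n≤o (length ls) fits))

-- Simulation of a machine by a local rule

module Simulation {A : Set} (M : Machine A ⊥) where

  open Machine M
  open Columns {A ⊎ Work}

  Actions : Set
  Actions = Vec (Symbol × Move) tapes

  -- A configuration becomes a block of letters, one per column.  All of them
  -- carry the actions that led to the configuration; only the first carries the
  -- control state, which is nothing in an additional initial configuration.
  -- A letter of the left summand is the verdict of a halted run.
  Letter : Set
  Letter = Bool ⊎ (Maybe (Maybe State) × Actions × Vec Column tapes)

  pattern verdict b    = inj₁ b
  pattern cell q as cs = inj₂ (q , as , cs)

  no-columns : Vec Column tapes
  no-columns = replicate tapes (nothing , nothing)

  idle : Actions
  idle = replicate tapes (nothing , stay)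

  -- These lead from the additional initial configuration to that of the machine, by moving the
  -- first head from the added blank onto the input.
  first-actions : Actions
  first-actions = (nothing , right) ∷ replicate extraTapes (nothing , stay)

  decide : Maybe State → Vec Symbol tapes → Bool ⊎ (State × Actions)
  decide nothing  h = inj₂ (initialState , first-actions)
  decide (just q) h with transition q h
  ... | nothing            = inj₁ (accepting q)
  ... | just (q′ , as , _) = inj₂ (q′ , as)

  -- The right neighbour of the last column of a block is the first letter of the next block. It
  -- must count as blank, which is correct because the tapes fit into the block.
  columns : Letter → Vec Column tapes
  columns (cell nothing _ cs) = cs
  columns _                   = no-columns

  leftColumn : Symbol × Move → Letter → Fin tapes → Column
  leftColumn a (cell (just _) _ cs) i = written a (lookup cs i)
  leftColumn a (cell nothing  _ cs) i = lookup cs i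
  leftColumn a (verdict _)          i = nothing , nothing

  firstLetter : Vec Column tapes → Letter → Bool ⊎ (State × Actions) → Letter
  firstLetter cs c (inj₁ v)        = verdict v
  firstLetter cs c (inj₂ (q , as)) =
    cell (just (just q)) as (tabulate λ i → firstColumn (lookup as i) (lookup cs i) (lookup (columns c) i))

  -- The letter one block after b, where a and c are the neighbours of b and e
  -- is the letter before the new one.
  local : Letter → Letter → Letter → Letter → Letter
  local a b                    c (verdict v)   = verdict v
  local a (verdict v)          c (cell _ _  _) = verdict v
  local a (cell (just q) _ cs) c (cell _ _  _) = firstLetter cs c (decide q (Vec.map proj₂ cs))
  local a (cell nothing  _ cs) c (cell _ as _) =
    cell nothing as (tabulate λ i →
      laterColumn (lookup as i) (leftColumn (lookup as i) a i) (lookup cs i) (lookup (columns c) i))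

  Tapes : Set
  Tapes = Vec (Tape Symbol) tapes

  block : Actions → Maybe State → Tapes → ℕ → Letter
  block as q ts zero    = cell (just q) as (Vec.map (column 0) ts)
  block as q ts (suc j) = cell nothing  as (Vec.map (column (suc j)) ts)

  perform : Tapes → Actions → Tapes
  perform = zipWith (writeMove blank)

  heads : (ts : Tapes) → Vec.map proj₂ (Vec.map (column 0) ts) ≡ Vec.map Tape.head ts
  heads ts = trans (sym (map-∘ proj₂ (column 0) ts)) (map-cong (λ _ → refl) ts)

  local-first : ∀ {as q ts a e} → (∃[ x ] e ≡ inj₂ x) →
    local a (block as q ts 0) (block as q ts 1) e ≡
      firstLetter (Vec.map (column 0) ts) (block as q ts 1) (decide q (Vec.map Tape.head ts))
  local-first {as} {q} {ts} {a} (x , refl) =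
    cong (λ h → firstLetter (Vec.map (column 0) ts) (block as q ts 1) (decide q h)) (heads ts)

  block-first : ∀ {as q ts q′ as′} →
    firstLetter (Vec.map (column 0) ts) (block as q ts 1) (inj₂ (q′ , as′)) ≡ block as′ (just q′) (perform ts as′) 0
  block-first {as} {q} {ts} {q′} {as′} = cong (cell _ as′) (tabulate-≡ eq)
    where
    open ≡-Reasoning
    eq : ∀ i → firstColumn (lookup as′ i) (lookup (Vec.map (column 0) ts) i) (lookup (Vec.map (column 1) ts) i)
       ≡ lookup (Vec.map (column 0) (perform ts as′)) i
    eq i = begin
      firstColumn (lookup as′ i) (lookup (Vec.map (column 0) ts) i) (lookup (Vec.map (column 1) ts) i)
        ≡⟨ cong₂ (firstColumn (lookup as′ i)) (lookup-map i (column 0) ts) (lookup-map i (column 1) ts) ⟩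
      firstColumn (lookup as′ i) (column 0 (lookup ts i)) (column 1 (lookup ts i))
        ≡⟨ column-first (lookup as′ i) (lookup ts i) ⟩
      column 0 (writeMove blank (lookup ts i) (lookup as′ i))
        ≡⟨ cong (column 0) (lookup-zipWith (writeMove blank) i ts as′) ⟨
      column 0 (lookup (perform ts as′) i)
        ≡⟨ lookup-map i (column 0) (perform ts as′) ⟨
      lookup (Vec.map (column 0) (perform ts as′)) i ∎

  -- The right neighbour c enters only through its `columns`, so that it may also be the first
  -- letter of the following block.
  block-later : ∀ {as q ts q′ as′ c} j → columns c ≡ Vec.map (column (2 + j)) ts →
    local (block as q ts j) (block as q ts (1 + j)) c (block as′ q′ (perform ts as′) j) ≡
      block as′ q′ (perform ts as′) (1 + j)
  block-later {as} {q} {ts} {q′} {as′} {c} j columns≡ =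
    trans (unfold j) (cong (cell _ as′) (tabulate-≡ (eq j columns≡)))
    where
    open ≡-Reasoning
    new : ℕ → Fin tapes → Column
    new j i = laterColumn (lookup as′ i) (leftColumn (lookup as′ i) (block as q ts j) i)
      (lookup (Vec.map (column (1 + j)) ts) i) (lookup (columns c) i)

    unfold : ∀ j → local (block as q ts j) (block as q ts (1 + j)) c (block as′ q′ (perform ts as′) j) ≡
      cell nothing as′ (tabulate (new j))
    unfold zero    = refl
    unfold (suc j) = refl

    leftNeighbour : ℕ → Fin tapes → Column
    leftNeighbour zero    i = written (lookup as′ i) (column 0 (lookup ts i))
    leftNeighbour (suc j) i = column (suc j) (lookup ts i)

    leftColumn≡ : ∀ j i → leftColumn (lookup as′ i) (block as q ts j) i ≡ leftNeighbour j i
    leftColumn≡ zero    i = cong (written (lookup as′ i)) (lookup-map i (column 0) ts)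
    leftColumn≡ (suc j) i = lookup-map i (column (suc j)) ts

    column≡ : ∀ j i →
      laterColumn (lookup as′ i) (leftNeighbour j i) (column (1 + j) (lookup ts i)) (column (2 + j) (lookup ts i)) ≡
        column (1 + j) (writeMove blank (lookup ts i) (lookup as′ i))
    column≡ zero    i = column-second (lookup as′ i) (lookup ts i)
    column≡ (suc j) i = column-later (lookup as′ i) (lookup ts i) j

    eq : ∀ j → columns c ≡ Vec.map (column (2 + j)) ts → ∀ i →
      new j i ≡ lookup (Vec.map (column (1 + j)) (perform ts as′)) i
    eq j columns≡ i = begin
      new j i
        ≡⟨ cong₂ (λ x → laterColumn (lookup as′ i) x (lookup (Vec.map (column (1 + j)) ts) i)) (leftColumn≡ j i)
             (trans (cong (λ v → lookup v i) columns≡) (lookup-map i (column (2 + j)) ts)) ⟩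
      laterColumn (lookup as′ i) (leftNeighbour j i) (lookup (Vec.map (column (1 + j)) ts) i) (column (2 + j) (lookup ts i))
        ≡⟨ cong (λ x → laterColumn (lookup as′ i) (leftNeighbour j i) x (column (2 + j) (lookup ts i)))
             (lookup-map i (column (1 + j)) ts) ⟩
      laterColumn (lookup as′ i) (leftNeighbour j i) (column (1 + j) (lookup ts i)) (column (2 + j) (lookup ts i))
        ≡⟨ column≡ j i ⟩
      column (1 + j) (writeMove blank (lookup ts i) (lookup as′ i))
        ≡⟨ cong (column (1 + j)) (lookup-zipWith (writeMove blank) i ts as′) ⟨
      column (1 + j) (lookup (perform ts as′) i)
        ≡⟨ lookup-map i (column (1 + j)) (perform ts as′) ⟨
      lookup (Vec.map (column (1 + j)) (perform ts as′)) i ∎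

  columns-beyond : ∀ {n j} (ts : Vec (Tape Symbol) n) → Vec.sum (Vec.map size ts) ≤ j →
    Vec.map (column j) ts ≡ replicate n (nothing , nothing)
  columns-beyond []       _    = refl
  columns-beyond (t ∷ ts) fits = cong₂ _∷_ (column-beyond t (m+n≤o⇒m≤o (size t) fits))
    (columns-beyond ts (m+n≤o⇒n≤o (size t) fits))

  -- The head starts on the blank left of the input, so that the letter which
  -- carries the control state does not depend on the input.
  initial-tapes : List A → Tapes
  initial-tapes w = tape [] nothing (inputCells w) ∷ replicate extraTapes (tape [] nothing [])

  startLetter blankLetter : Letter
  startLetter = cell (just nothing) idle no-columns
  blankLetter = cell nothing idle no-columns

  inputLetter : A → Letter
  inputLetter a = cell nothing idle ((nothing , just (inj₁ a)) ∷ replicate extraTapes (nothing , nothing))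

  letters : List A → ℕ → List Letter
  letters w b = startLetter ∷ map inputLetter w ++ List.replicate b blankLetter

  Prefix-letters : ∀ w b → Prefix (letters w b) (block idle nothing (initial-tapes w))
  Prefix-letters w b =
    cong (λ cs → cell (just nothing) idle ((nothing , nothing) ∷ cs)) (Vec.map-replicate (column 0) _ extraTapes) ,
    input w b (λ j → cong (λ cs → cell nothing idle ((nothing , nth (inputCells w) j) ∷ cs))
      (Vec.map-replicate (column (suc j)) _ extraTapes))
    where
    input : ∀ w b {s} →
      (∀ j → s j ≡ cell nothing idle ((nothing , nth (inputCells w) j) ∷ replicate extraTapes (nothing , nothing))) →
      Prefix (map inputLetter w ++ List.replicate b blankLetter) s
    input []      zero    e = tt
    input []      (suc b) e = e 0 , input [] b (e ∘ suc)
    input (a ∷ w) b       e = e 0 , input w b (e ∘ suc)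

  -- Only the columns agree, not the tapes: the first head leaves behind a represented blank, which
  -- `nth` does not distinguish from an unvisited cell.
  initial-columns : ∀ w j →
    Vec.map (column j) (perform (initial-tapes w) first-actions) ≡
      Vec.map (column j) (proj₂ (initial M w))
  initial-columns w j = cong₂ _∷_ (input w j) (cong (Vec.map (column j)) (zipWith-replicate (writeMove blank) _ _))
    where
    input : ∀ w j → column j (writeMove blank (tape [] nothing (inputCells w)) (nothing , right)) ≡
      column j (fromList blank (inputCells w))
    input []      zero    = refl
    input []      (suc j) = refl
    input (a ∷ w) zero    = refl
    input (a ∷ w) (suc j) = refl

  block-cong : ∀ {as q ts ts′} → (∀ j → Vec.map (column j) ts ≡ Vec.map (column j) ts′) →
    ∀ j → block as q ts j ≡ block as q ts′ j
  block-cong e zero    = cong (cell _ _) (e 0)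
  block-cong e (suc j) = cong (cell _ _) (e (suc j))

  cells≤space : ∀ {c} (r : Run M c) → cells M c ≤ space r
  cells≤space (halt _)   = ≤-refl
  cells≤space (step _ r) = m≤m⊔n _ _

  -- The added blank may take one cell more than the machine uses, which is why a block is longer
  -- than the space bound.
  initial-size : ∀ w → Vec.sum (Vec.map size (initial-tapes w)) ≤ suc (cells M (initial M w))
  initial-size w = +-monoˡ-≤ _ (input w)
    where
    input : ∀ w → size (tape [] nothing (inputCells w)) ≤ suc (size (fromList blank (inputCells w)))
    input []      = s≤s z≤n
    input (a ∷ w) = ≤-refl

  cons : Letter → (ℕ → Letter) → ℕ → Letter
  cons a s zero    = a
  cons a s (suc j) = s j

  chosen : State → Vec Symbol tapes → Actions
  chosen q h with decide (just q) h
  ... | inj₁ _        = idle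
  ... | inj₂ (_ , as) = as

  module Stream (k : ℕ) (1≤k : 1 ≤ k) where

    private
      m : ℕ
      m = suc k

    mutual
      trace : Actions → ∀ {q ts} → Run M (q , ts) → ℕ → Letter
      trace as {q} {ts} r = append m (block as (just q) ts) (rest r)

      rest : ∀ {q ts} → Run M (q , ts) → ℕ → Letter
      rest {q} (halt _)        = λ _ → verdict (accepting q)
      rest {q} {ts} (step _ r) = trace (chosen q (Vec.map Tape.head ts)) r

    -- The letter `a` stands just before the sequence. It allows the recurrence to be proved block
    -- by block, each block supplying the `a` of what comes after it.
    Follows : Letter → (ℕ → Letter) → Set
    Follows a s = ∀ t → s (m + t) ≡ local (cons a s t) (s t) (s (suc t)) (s (k + t))

    -- Here `first` is the case t = 0, where the new letter opens a block, and `later` covers the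
    -- other t below m. In `later` the right neighbour may already belong to h, hence the `append`
    -- in its statement.
    Follows-append : ∀ {a g h} → h 0 ≡ local a (g 0) (g 1) (g k) →
      (∀ j → suc j < m → h (suc j) ≡ local (g j) (g (suc j)) (append m g h (2 + j)) (h j)) →
      Follows (g k) h → Follows a (append m g h)
    Follows-append {a} {g} {h} first later follows = go
      where
      s = append m g h
      g≡ : ∀ {j} → j < m → g j ≡ s j
      g≡ j<m = sym (append-< g h j<m)
      h≡ : ∀ {i} j → i ≡ m + j → h j ≡ s i
      h≡ j refl = sym (append-+ m g h j)

      go : ∀ t → s (m + t) ≡ local (cons a s t) (s t) (s (suc t)) (s (k + t))
      go t with m ≤? t
      go zero | no _ = trans (append-+ m g h 0) (trans first
        (cong₄ local refl refl (g≡ (s≤s 1≤k)) (trans (g≡ ≤-refl) (cong s (sym (+-identityʳ k))))))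
      go (suc j) | no m≰t = trans (append-+ m g h (suc j)) (trans (later j j<m)
        (cong₄ local (g≡ (<-trans (n<1+n j) j<m)) (g≡ j<m) refl (h≡ j (+-suc k j))))
        where j<m = ≰⇒> m≰t
      go t | yes m≤t with m≤n⇒∃[o]m+o≡n m≤t
      ... | u , refl = trans (append-+ m g h (m + u)) (trans (follows u)
        (cong₄ local (cons≡ u) (h≡ u refl) (h≡ (suc u) (sym (+-suc m u))) (h≡ (k + u) (+-suc k (k + u)))))
        where
        cons≡ : ∀ u → cons (g k) h u ≡ s (k + u)
        cons≡ zero    = trans (g≡ ≤-refl) (cong s (sym (+-identityʳ k)))
        cons≡ (suc u) = h≡ u (+-suc k u)

    block-cell : ∀ {as q ts} j → ∃[ x ] block as q ts j ≡ inj₂ x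
    block-cell zero    = _ , refl
    block-cell (suc j) = _ , refl

    Follows-halt : ∀ {as q ts a} → decide (just q) (Vec.map Tape.head ts) ≡ inj₁ (accepting q) →
      Follows a (append m (block as (just q) ts) (λ _ → verdict (accepting q)))
    Follows-halt {as} {q} {ts} halted = Follows-append {g = block as (just q) ts}
      (sym (trans (local-first (block-cell k))
        (cong (firstLetter (Vec.map (column 0) ts) (block as (just q) ts 1)) halted)))
      -- A verdict before the new letter is copied, whatever the block above contains.
      (λ _ _ → refl)
      (λ _ → refl)

    Follows-step : ∀ {as q ts q′ as′ a s} → Vec.sum (Vec.map size ts) ≤ m →
      decide q (Vec.map Tape.head ts) ≡ inj₂ (q′ , as′) →
      (∀ {j} → j < m → s j ≡ block as′ (just q′) (perform ts as′) j) →
      Follows (block as q ts k) s → Follows a (append m (block as q ts) s)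
    Follows-step {as} {q} {ts} {q′} {as′} {a} {s} fits decided s≡ = Follows-append {g = block as q ts}
      (trans (s≡ (s≤s z≤n)) (sym (trans (local-first (block-cell k))
        (trans (cong (firstLetter (Vec.map (column 0) ts) (block as q ts 1)) decided) (block-first {as} {q})))))
      λ j j<m → trans (s≡ j<m) (sym (trans (cong (local _ _ _) (s≡ (<-trans (n<1+n j) j<m)))
        (block-later {as} {q} j (next-columns j j<m))))
      where
      next-columns : ∀ j → suc j < m → columns (append m (block as q ts) s (2 + j)) ≡ Vec.map (column (2 + j)) ts
      next-columns j j<m with m≤n⇒m<n∨m≡n j<m
      ... | inj₁ 2+j<m = cong columns (append-< (block as q ts) s 2+j<m)
      ... | inj₂ refl  = trans (cong columns (trans (cong (append m (block as q ts) s) (sym (+-identityʳ m)))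
        (trans (append-+ m (block as q ts) s 0) (s≡ (s≤s z≤n))))) (sym (columns-beyond ts fits))

    decide-halt : ∀ {q ts} → next M (q , ts) ≡ nothing →
      decide (just q) (Vec.map Tape.head ts) ≡ inj₁ (accepting q)
    decide-halt {q} {ts} e with transition q (Vec.map Tape.head ts)
    ... | nothing = refl

    decide-step : ∀ {q ts q′ ts′ w} → next M (q , ts) ≡ just ((q′ , ts′) , w) →
      let as = chosen q (Vec.map Tape.head ts) in
      decide (just q) (Vec.map Tape.head ts) ≡ inj₂ (q′ , as) × ts′ ≡ perform ts as
    decide-step {q} {ts} e with transition q (Vec.map Tape.head ts)
    decide-step {q} {ts} refl | just (q′ , as , w) = refl , refl

    trace-follows : ∀ {q ts} (r : Run M (q , ts)) as a → space r ≤ m → Follows a (trace as r)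
    trace-follows (halt e) as a fits = Follows-halt (decide-halt e)
    trace-follows {q} {ts} (step e r) as a fits with decide-step e
    ... | decided , refl = Follows-step (m⊔n≤o⇒m≤o _ _ fits) decided (append-< _ _)
      (trace-follows r _ _ (m⊔n≤o⇒n≤o _ _ fits))

    trace-accepts : ∀ {q ts} (r : Run M (q , ts)) as → accepts r ≡ true →
      ∃[ n ] ∀ j → trace as r (n + j) ≡ verdict true
    trace-accepts {q} {ts} (halt e) as acc = m , λ j → trans (append-+ m (block as (just q) ts) _ j) (cong inj₁ acc)
    trace-accepts {q} {ts} (step e r) as acc with trace-accepts r _ acc
    ... | n , all = m + n , λ j → trans (cong (trace as (step e r)) (+-assoc m n j))
      (trans (append-+ m (block as (just q) ts) _ (n + j)) (all j))

    block-undecided : ∀ {as q ts} j → block as q ts j ≢ verdict true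
    block-undecided zero    ()
    block-undecided (suc j) ()

    trace-rejects : ∀ {q ts} (r : Run M (q , ts)) as → accepts r ≡ false → ∀ j → trace as r j ≢ verdict true
    trace-rejects {q} {ts} (halt e) as rej =
      append-all m (_≢ verdict true) (block-undecided {as} {just q} {ts}) λ _ → rejected
      where
      rejected : verdict (accepting q) ≢ verdict true
      rejected e with () ← trans (sym rej) (inj₁-injective e)
    trace-rejects {q} {ts} (step e r) as rej =
      append-all m (_≢ verdict true) (block-undecided {as} {just q} {ts}) (trace-rejects r _ rej)

    module _ {w} (r : Run M (initial M w)) where

      stream : ℕ → Letter
      stream = append m (block idle nothing (initial-tapes w)) (trace first-actions r)

      stream-prefix : ∀ b → length (letters w b) ≤ m → Prefix (letters w b) stream
      stream-prefix b len =
        Prefix-append (letters w b) {g = block idle nothing (initial-tapes w)} len (Prefix-letters w b)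

      stream-follows : space r ≤ k → ∀ a → Follows a stream
      stream-follows fits a = Follows-step (≤-trans (initial-size w) (s≤s (≤-trans (cells≤space r) fits))) refl
        (λ {j} j<m → trans (append-< (block first-actions (just initialState) (proj₂ (initial M w))) _ j<m)
          (sym (block-cong (initial-columns w) j)))
        (trace-follows r first-actions _ (m≤n⇒m≤1+n fits))

      stream-accepts : accepts r ≡ true → ∃[ n ] ∀ j → stream (n + j) ≡ verdict true
      stream-accepts acc with trace-accepts r first-actions acc
      ... | n , all = m + n , λ j → trans (cong stream (+-assoc m n j))
        (trans (append-+ m (block idle nothing (initial-tapes w)) _ (n + j)) (all j))

      stream-rejects : accepts r ≡ false → ∀ j → stream j ≢ verdict true
      stream-rejects rej = append-all m (_≢ verdict true) (block-undecided {idle} {nothing} {initial-tapes w})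
        (trace-rejects r first-actions rej)

  Recurrent : ℕ → (ℕ → Letter) → Set
  Recurrent k s = ∀ t → s (3 + (k + t)) ≡ local (s t) (s (1 + t)) (s (2 + t)) (s (2 + (k + t)))

  abstract
    -- The blank letter put in front is the left neighbour of the start letter, so the recurrence
    -- holds from t = 0 on without a boundary case. The bound `2 + k` on the length of `letters w b`
    -- is the block length.
    simulation : ∀ {w} (r : Run M (initial M w)) k b → space r ≤ suc k → length (letters w b) ≤ 2 + k →
      ∃[ s ] (Recurrent k s × Prefix (blankLetter ∷ letters w b) s ×
        (accepts r ≡ true → ∃[ n ] ∀ j → s (n + j) ≡ verdict true) × (accepts r ≡ false → ∀ j → s j ≢ verdict true))
    simulation r k b fits len =
      cons blankLetter (stream r) , stream-follows r fits blankLetter , (refl , stream-prefix r b len) ,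
      (λ e → let n , all = stream-accepts r e in suc n , all) ,
      (λ { e zero () ; e (suc j) → stream-rejects r e j })
      where open Stream (suc k) (s≤s z≤n)

-- Recurrent sequences in MITL[F₀]

Prefix-cong : ∀ {V : Set} (xs : List V) {s s′} → (∀ j → s j ≡ s′ j) → Prefix xs s → Prefix xs s′
Prefix-cong []       eq _        = tt
Prefix-cong (x ∷ xs) eq (e , es) = trans (sym (eq 0)) e , Prefix-cong xs (eq ∘ suc) es

nextInterval soonInterval anyInterval : Interval
nextInterval = bounded closed 0 closed 1 (s≤s z≤n)
soonInterval = bounded closed 0 open′ 1 (s≤s z≤n)
anyInterval  = unbounded closed 0

module _ {n : ℕ} where

  infixr 6 _∧′_

  _∧′_ : Formula n → Formula n → Formula n
  φ ∧′ ψ = ¬′ ((¬′ φ) ∨′ (¬′ ψ))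

  -- The next position, provided that consecutive ones are at distance at least 1.
  X : Formula n → Formula n
  X = F nextInterval

  X^ : ℕ → Formula n → Formula n
  X^ zero    φ = φ
  X^ (suc k) φ = X (X^ k φ)

  -- Formulas have no constant for truth, so some letter z is needed to express it.
  true′ : Fin n → Formula n
  true′ z = atom z ∨′ (¬′ atom z)

  spaced : Fin n → Formula n
  spaced z = ¬′ F soonInterval (true′ z)

  globally : Formula n → Formula n
  globally φ = ¬′ F anyInterval (¬′ φ)

  chain : Fin n → List (Fin n) → Formula n
  chain z []       = true′ z
  chain z (x ∷ xs) = X (atom x ∧′ chain z xs)

  case : Fin n → (Fin n → Formula n) → List (Fin n) → Formula n
  case z ψ []       = ¬′ true′ z
  case z ψ (a ∷ as) = (atom a ∧′ ψ a) ∨′ case z ψ as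

  byLetter : Fin n → (Fin n → Formula n) → Formula n
  byLetter z ψ = case z ψ (allFin n)

module Recurrence {n : ℕ} (local : Fin n → Fin n → Fin n → Fin n → Fin n) (acc : Fin n) (k : ℕ) where

  -- The nested case distinctions produce n^3 copies of the chain `X^ k`. As the alphabet depends
  -- only on the machine, this is a constant factor.
  recurrence : Formula n
  recurrence =
    byLetter acc λ a → X (byLetter acc λ b → X (byLetter acc λ c →
      X^ k (byLetter acc λ e → X (atom (local a b c e)))))

  -- At position 0 no spacing is imposed, so the first `X` of the chain may skip positions; the
  -- sequence starts wherever it leads. The letters `acc` are exempt from the recurrence, which is
  -- what allows a model to end.
  formula : List (Fin n) → Formula n
  formula xs = chain acc xs ∧′ globally (spaced acc ∧′ (atom acc ∨′ recurrence))

  Recurrent : (ℕ → Fin n) → Set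
  Recurrent s = ∀ t → s (3 + (k + t)) ≡ local (s t) (s (1 + t)) (s (2 + t)) (s (2 + (k + t)))

  -- A model refutes rejection

  module Soundness (ρ : TimedWord n) where

    open TimedWord ρ renaming (time to timestamp)

    infix 4 _⊩_
    _⊩_ : Position → Formula n → Set
    _⊩_ = _⊨_ ρ

    ⊩-true : ∀ {z} i → i ⊩ true′ z
    ⊩-true {z} i with letter i Fin.≟ z
    ... | yes e = inj₁ e
    ... | no ¬e = inj₂ ¬e

    -- The De Morgan conjunction does not yield its parts outright, only to a continuation into ⊥.
    -- The other eliminations inherit this style.
    ∧-elim : ∀ {φ ψ} i → i ⊩ φ ∧′ ψ → (i ⊩ φ → i ⊩ ψ → ⊥) → ⊥
    ∧-elim i h c = h (inj₁ λ p → h (inj₂ λ q → c p q))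

    case-elim : ∀ {z ψ} as i → i ⊩ case z ψ as → (i ⊩ ψ (letter i) → ⊥) → ⊥
    case-elim []       i h        c = h (⊩-true i)
    case-elim (a ∷ as) i (inj₁ h) c = ∧-elim i h λ { refl → c }
    case-elim (a ∷ as) i (inj₂ h) c = case-elim as i h c

    Spaced : Set
    Spaced = ∀ i → 0 < toℕ i → i ⊩ spaced acc

    -- This includes that the word reaches position p, and it is this part from which the final
    -- contradiction is drawn.
    At : ℕ → Fin n → Set
    At p a = ∃[ i ] (toℕ i ≡ p × letter i ≡ a)

    At-letter : ∀ {p a} i → toℕ i ≡ p → At p a → letter i ≡ a
    At-letter i e (j , e′ , refl) = cong letter (toℕ-injective (trans e (sym e′)))

    module _ (spacing : Spaced) where

      -- If the witness j skipped the position m next to i, then m would be strictly earlier than j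
      -- and so at distance less than 1 from i, against the spacing at i.
      X-elim : ∀ {φ} i → 0 < toℕ i → i ⊩ X φ → ∃[ j ] (toℕ j ≡ suc (toℕ i) × j ⊩ φ)
      X-elim i 0<i (j , i<j , (_ , j-i≤1) , h) with m≤n⇒m<n∨m≡n i<j
      ... | inj₂ e = j , sym e , h
      ... | inj₁ 1+i<j = contradiction
        (m , i<m , (<⇒0≤- {timestamp i} {timestamp m} (strict i m i<m)
                 , -‿<-≤-trans {timestamp m} {timestamp j} (timestamp i) 1 (strict m j m<j) j-i≤1)
           , ⊩-true m)
        (spacing i 0<i)
        where
        1+i<last = <-trans 1+i<j (toℕ<n j)
        m : Position
        m = fromℕ< 1+i<last
        i<m : i Fin.< m
        i<m = ≤-reflexive (sym (toℕ-fromℕ< 1+i<last))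
        m<j : m Fin.< j
        m<j = subst (_< toℕ j) (sym (toℕ-fromℕ< 1+i<last)) 1+i<j

      X^-elim : ∀ {φ} k i → 0 < toℕ i → i ⊩ X^ k φ → ∃[ j ] (toℕ j ≡ k + toℕ i × j ⊩ φ)
      X^-elim zero    i 0<i h = i , refl , h
      X^-elim (suc k) i 0<i h with j , j≡ , h′ ← X-elim i 0<i h
        with l , l≡ , h″ ← X^-elim k j (subst (0 <_) (sym j≡) (s≤s z≤n)) h′ =
        l , trans l≡ (trans (cong (k +_) j≡) (+-suc k (toℕ i))) , h″

      chain-elim : ∀ {z s} xs i → 0 < toℕ i → Prefix xs s → i ⊩ chain z xs →
        ((∀ {t} → t < length xs → At (suc (toℕ i + t)) (s t)) → ⊥) → ⊥
      chain-elim []       i 0<i _        h c = c λ ()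
      chain-elim {z} {s} (x ∷ xs) i 0<i (e , es) h c with j , j≡ , h′ ← X-elim i 0<i h =
        ∧-elim {atom x} {chain z xs} j h′ λ letter≡ h″ →
          chain-elim xs j (subst (0 <_) (sym j≡) (s≤s z≤n)) es h″ λ later → c λ
            { {zero}  _         → j , trans j≡ (cong suc (sym (+-identityʳ (toℕ i)))) , trans letter≡ (sym e)
            ; {suc t} (s≤s t<l) → subst (λ p → At p (s (suc t)))
                (cong suc (trans (cong (_+ t) j≡) (sym (+-suc (toℕ i) t)))) (later t<l) }

      recurrence-elim : ∀ {p s t} → 0 < p → (∀ {u} → u < 3 + (k + t) → At (p + u) (s u)) → Recurrent s →
        ∀ i → toℕ i ≡ p + t → i ⊩ recurrence → ¬ ¬ At (p + (3 + (k + t))) (s (3 + (k + t)))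
      recurrence-elim {p} {s} {t} 0<p known rec i i≡ h c =
        case-elim (allFin n) i h λ h → let b , b≡ , h = X-elim i 0<i h
                                           b≡′ = trans b≡ (trans (cong suc i≡) (sym (+-suc p t))) in
        case-elim (allFin n) b h λ h → let c′ , c≡ , h = X-elim b (positive b≡) h
                                           c≡′ = trans c≡ (trans (cong suc b≡′) (sym (+-suc p (1 + t)))) in
        case-elim (allFin n) c′ h λ h → let e , e≡ , h = X^-elim k c′ (positive c≡) h
                                            e≡′ = trans e≡ (trans (cong (k +_) c≡′) (shift k p t)) in
        case-elim (allFin n) e h λ h → let d , d≡ , letter≡ = X-elim e (subst (0 <_) (sym e≡)
                                                                     (≤-trans (positive c≡) (m≤n+m _ k))) h in
        c (d , trans d≡ (trans (cong suc e≡′) (sym (+-suc p _))) , trans letter≡ (trans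
          (cong₄ local (At-letter i i≡ (known (s≤s (≤-trans t≤k+t (m≤n+m _ 2)))))
                       (At-letter b b≡′ (known (s≤s (s≤s (≤-trans t≤k+t (m≤n+m _ 1))))))
                       (At-letter c′ c≡′ (known (s≤s (s≤s (s≤s t≤k+t)))))
                       (At-letter e e≡′ (known ≤-refl)))
          (sym (rec t))))
        where
        positive : ∀ {i j : Position} → toℕ j ≡ suc (toℕ i) → 0 < toℕ j
        positive e = subst (0 <_) (sym e) (s≤s z≤n)
        shift : ∀ k p t → k + (p + (2 + t)) ≡ p + (2 + (k + t))
        shift = ℕ-Ring.solve-∀
        t≤k+t : t ≤ k + t
        t≤k+t = m≤n+m t k
        0<i : 0 < toℕ i
        0<i = subst (0 <_) (sym i≡) (≤-trans 0<p (m≤m+n p t))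

      module _ (obeys : ∀ i → 0 < toℕ i → letter i ≢ acc → ¬ ¬ (i ⊩ recurrence))
               {p s} (0<p : 0 < p) (recurrent : Recurrent s) (undecided : ∀ t → s t ≢ acc) where

        -- As long as no letter is `acc`, the recurrence forces one more letter of s, and the known
        -- window grows by one position per round. With `fuel + t` exceeding the last position, this
        -- outgrows the word.
        unbounded-word : ∀ fuel t → suc last ≤ fuel + t → (∀ {u} → u < 3 + (k + t) → At (p + u) (s u)) → ⊥
        unbounded-word zero t last< known
          with i , i≡ , _ ← known {t} (≤-trans (s≤s (m≤n+m t k)) (m≤n+m _ 2)) =
          <⇒≱ (toℕ<n i) (≤-trans last< (≤-trans (m≤n+m t p) (≤-reflexive (sym i≡))))
        unbounded-word (suc fuel) t last< known
          with i , i≡ , letter≡ ← known {t} (≤-trans (s≤s (m≤n+m t k)) (m≤n+m _ 2)) =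
          obeys i (subst (0 <_) (sym i≡) (≤-trans 0<p (m≤m+n p t))) (undecided t ∘ trans (sym letter≡)) λ h →
            recurrence-elim 0<p known recurrent i i≡ h λ new →
              unbounded-word fuel (suc t) (≤-trans last< (≤-reflexive (sym (+-suc fuel t)))) λ {u} u< →
                known′ new u (m<1+n⇒m<n∨m≡n (subst (u <_) (cong (3 +_) (+-suc k t)) u<))
          where
          known′ : At (p + (3 + (k + t))) (s (3 + (k + t))) →
            ∀ u → u < 3 + (k + t) ⊎ u ≡ 3 + (k + t) → At (p + u) (s u)
          known′ new u (inj₁ u<)   = known u<
          known′ new u (inj₂ refl) = new

    unsatisfied : ∀ {x s} xs → 3 + k ≤ length (x ∷ xs) → Prefix (x ∷ xs) s →
      Recurrent s → (∀ t → s t ≢ acc) → ¬ (zero ⊩ formula (x ∷ xs))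
    unsatisfied {x} {s} xs long (e , es) recurrent undecided h =
      ∧-elim {chain acc (x ∷ xs)} {globally (spaced acc ∧′ (atom acc ∨′ recurrence))} zero h λ (j , 0<j , _ , h₁) h₂ →
      let always : ∀ i → 0 < toℕ i → ¬ ¬ (i ⊩ spaced acc ∧′ (atom acc ∨′ recurrence))
          always i 0<i ¬h = h₂ (i , 0<i , <⇒0≤- {timestamp zero} {timestamp i} (strict zero i 0<i) , ¬h)
          spacing : Spaced
          spacing i 0<i soon = always i 0<i λ h →
            ∧-elim {spaced acc} {atom acc ∨′ recurrence} i h λ ¬soon _ → ¬soon soon
          obeys : ∀ i → 0 < toℕ i → letter i ≢ acc → ¬ ¬ (i ⊩ recurrence)
          obeys i 0<i ≢acc ¬h = always i 0<i λ h → ∧-elim {spaced acc} {atom acc ∨′ recurrence} i h λ where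
            _ (inj₁ ≡acc) → ≢acc ≡acc
            _ (inj₂ h)    → ¬h h
      in ∧-elim {atom x} {chain acc xs} j h₁ λ letter≡ h₁ →
         chain-elim spacing xs j 0<j es h₁ λ later →
         unbounded-word spacing obeys 0<j recurrent undecided (suc last) 0 (≤-reflexive (sym (+-identityʳ _))) λ
           { {zero}  _         → j , sym (+-identityʳ _) , trans letter≡ (sym e)
           ; {suc u} (s≤s u<) → subst (λ p → At p (s (suc u))) (sym (+-suc (toℕ j) u))
               (later (≤-trans u< (≤-trans (≤-reflexive (cong (2 +_) (+-identityʳ k))) (s≤s⁻¹ long)))) }

  -- A model from an accepting sequence

  module Completeness (s : ℕ → Fin n) (recurrent : Recurrent s) (v : ℕ) (accepted : ∀ t → s (v + t) ≡ acc) where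

    symbol : ℕ → Fin n
    symbol zero    = acc
    symbol (suc t) = s t

    private
      instant : ∀ {l} → Fin (suc l) → ℝ
      instant i = Real.fromℕ (toℕ i)

      instant-strict : ∀ {l} (i j : Fin (suc l)) → i Fin.< j → instant i Real.< instant j
      instant-strict i j i<j with o , e ← m≤n⇒∃[o]m+o≡n i<j =
        subst (λ q → instant i Real.< Real.fromℕ q) (trans (+-suc (toℕ i) o) e) (fromℕ-strict (toℕ i) o)

    word : TimedWord n
    word = record
      -- The letter `s t` is at position t + 1. The recurrence is claimed for t < v and reaches
      -- `s (3 + (k + t))`, whose position 4 + k + t is at most 3 + k + v. From t = v on, all
      -- letters are `acc`.
      { last   = 3 + (k + v)
      ; letter = λ i → symbol (toℕ i)
      ; time   = instant
      ; start  = Real-refl , Real-refl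
      ; strict = instant-strict
      }
      where
      Real-refl : Real.fromℕ 0 Real.≤ Real.fromℕ 0
      Real-refl = proj₁ (fromℕ-difference 0 0)

    open TimedWord word using (last; Position)

    infix 4 _⊩_
    _⊩_ : Position → Formula n → Set
    _⊩_ = _⊨_ word

    Holds : ℕ → Formula n → Set
    Holds q φ = ∃[ i ] (toℕ i ≡ q × i ⊩ φ)

    X-intro : ∀ {φ} i → Holds (suc (toℕ i)) φ → i ⊩ X φ
    X-intro i (j , j≡ , h) = j , i<j , (<⇒0≤- {instant i} {instant j} (instant-strict i j i<j) ,
      subst (λ q → Real.fromℕ q Real.- instant i Real.≤ Real.fromℕ 1) (trans (+-comm (toℕ i) 1) (sym j≡))
        (proj₁ (fromℕ-difference (toℕ i) 1))) , h
      where
      i<j : i Fin.< j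
      i<j = ≤-reflexive (sym j≡)

    Holds-X : ∀ {φ q} → q ≤ last → Holds (suc q) φ → Holds q (X φ)
    Holds-X {φ} {q} q≤ h = fromℕ< (s≤s q≤) , toℕ-fromℕ< (s≤s q≤) ,
      X-intro _ (subst (λ q → Holds (suc q) φ) (sym (toℕ-fromℕ< (s≤s q≤))) h)

    Holds-X^ : ∀ {φ q} k → k + q ≤ last → Holds (k + q) φ → Holds q (X^ k φ)
    Holds-X^ zero    _  h = h
    Holds-X^ {φ} {q} (suc k) k+q≤ h = Holds-X (≤-trans (m≤n+m q (suc k)) k+q≤)
      (Holds-X^ k (subst (_≤ last) (sym (+-suc k q)) k+q≤) (subst (λ q → Holds q φ) (sym (+-suc k q)) h))

    ∧-intro : ∀ {φ ψ} i → i ⊩ φ → i ⊩ ψ → i ⊩ φ ∧′ ψ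
    ∧-intro i h h′ (inj₁ ¬h)  = ¬h h
    ∧-intro i h h′ (inj₂ ¬h′) = ¬h′ h′

    case-intro : ∀ {z ψ as} i → symbol (toℕ i) ∈ as → i ⊩ ψ (symbol (toℕ i)) → i ⊩ case z ψ as
    case-intro {ψ = ψ} {a ∷ as} i (here refl) h = inj₁ (∧-intro {atom a} {ψ a} i refl h)
    case-intro {as = a ∷ as}    i (there a∈)  h = inj₂ (case-intro i a∈ h)

    Holds-byLetter : ∀ {z ψ q} → Holds q (ψ (symbol q)) → Holds q (byLetter z ψ)
    Holds-byLetter (i , refl , h) = i , refl , case-intro i (∈-allFin _) h

    Holds-atom : ∀ {q a} → q ≤ last → symbol q ≡ a → Holds q (atom a)
    Holds-atom q≤ e = fromℕ< (s≤s q≤) , toℕ-fromℕ< (s≤s q≤) , trans (cong symbol (toℕ-fromℕ< (s≤s q≤))) e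

    Holds⇒⊩ : ∀ {φ} i → Holds (toℕ i) φ → i ⊩ φ
    Holds⇒⊩ i (j , e , h) with refl ← toℕ-injective e = h

    Holds-chain : ∀ {z} q xs → q + length xs ≤ last → Prefix xs (λ t → symbol (suc (q + t))) → Holds q (chain z xs)
    Holds-chain {z} q [] q≤ _ = i , toℕ-fromℕ< _ , true-intro
      where
      i : Position
      i = fromℕ< (s≤s (≤-trans (m≤m+n q 0) q≤))
      true-intro : i ⊩ true′ z
      true-intro with symbol (toℕ i) Fin.≟ z
      ... | yes e = inj₁ e
      ... | no ¬e = inj₂ ¬e
    Holds-chain {z} q (x ∷ xs) q≤ (e , es) =
      Holds-X (≤-trans (n≤1+n q) (≤-trans (m≤m+n _ _) 1+q≤))
        (both (Holds-atom (≤-trans (m≤m+n _ _) 1+q≤) (trans (cong (symbol ∘ suc) (sym (+-identityʳ q))) e))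
              (Holds-chain (suc q) xs 1+q≤ (Prefix-cong xs (λ t → cong (symbol ∘ suc) (+-suc q t)) es)))
      where
      1+q≤ = subst (_≤ last) (+-suc q (length xs)) q≤
      both : Holds (suc q) (atom x) → Holds (suc q) (chain z xs) → Holds (suc q) (atom x ∧′ chain z xs)
      both (i , i≡ , h) h′ =
        i , i≡ , ∧-intro {atom x} {chain z xs} i h (Holds⇒⊩ i (subst (λ q → Holds q _) (sym i≡) h′))

    Holds-recurrence : ∀ t → t < v → Holds (suc t) recurrence
    Holds-recurrence t t<v =
      Holds-byLetter (Holds-X (below (s≤s z≤n)) (Holds-byLetter (Holds-X (below (s≤s (s≤s z≤n)))
        (Holds-byLetter (Holds-X^ k shifted
        (subst (λ q → Holds q (byLetter acc ψ)) (sym shift) (Holds-byLetter {ψ = ψ} (Holds-X (≤-trans (n≤1+n _) end)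
          (Holds-atom end (recurrent t))))))))))
      where
      ψ : Fin n → Formula n
      ψ e = X (atom (local (s t) (s (1 + t)) (s (2 + t)) e))
      shift : k + (3 + t) ≡ 3 + (k + t)
      shift = trans (+-suc k (2 + t)) (cong suc (trans (+-suc k (1 + t)) (cong suc (+-suc k t))))
      end : 4 + (k + t) ≤ last
      end = s≤s (s≤s (s≤s (≤-trans (≤-reflexive (sym (+-suc k t))) (+-monoʳ-≤ k t<v))))
      shifted : k + (3 + t) ≤ last
      shifted = ≤-trans (≤-reflexive shift) (≤-trans (n≤1+n _) end)
      below : ∀ {j} → j ≤ 3 → j + t ≤ last
      below j≤3 = ≤-trans (+-mono-≤ j≤3 (m≤n+m t k)) (≤-trans (n≤1+n _) end)

    satisfied : ∀ xs → length xs ≤ last → Prefix xs s → zero ⊩ formula xs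
    satisfied xs len prefix =
      ∧-intro {chain acc xs} {globally (spaced acc ∧′ (atom acc ∨′ recurrence))} zero
        (Holds⇒⊩ zero (Holds-chain 0 xs len prefix))
        λ (j , 0<j , _ , ¬h) → ¬h (∧-intro {spaced acc} {atom acc ∨′ recurrence} j (spacing j) (obeys j 0<j))
      where
      spacing : ∀ j → j ⊩ spaced acc
      spacing j (l , j<l , (_ , l-j<1) , _) with o , e ← m≤n⇒∃[o]m+o≡n j<l =
        fromℕ-difference≮1 (toℕ j) o (subst (λ q → Real.fromℕ q Real.- instant j Real.< Real.fromℕ 1)
          (trans (sym e) (sym (+-suc (toℕ j) o))) l-j<1)

      obeys : ∀ j → 0 < toℕ j → j ⊩ atom acc ∨′ recurrence
      obeys (suc i) _ with toℕ i <? v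
      ... | yes t<v = inj₂ (Holds⇒⊩ (suc i) (Holds-recurrence (toℕ i) t<v))
      ... | no  t≮v with o , e ← m≤n⇒∃[o]m+o≡n (≮⇒≥ t≮v) = inj₁ (trans (cong s (sym e)) (accepted o))

-- The reduction

Finite-↔ : ∀ {X Y : Set} → X ↔ Y → Finite Y → Finite X
Finite-↔ X↔Y (n , Y↔n) = n , ↔-trans X↔Y Y↔n

×-finite : ∀ {X Y : Set} → Finite X → Finite Y → Finite (X × Y)
×-finite (m , X↔m) (n , Y↔n) = m * n , ↔-trans (X↔m ×-↔ Y↔n) (↔-sym *↔×)

Maybe-finite : ∀ {X : Set} → Finite X → Finite (Maybe X)
Maybe-finite X-finite = Finite-↔
  (mk↔ₛ′ (λ { nothing → inj₁ tt ; (just x) → inj₂ x }) (λ { (inj₁ _) → nothing ; (inj₂ x) → just x })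
         (λ { (inj₁ _) → refl ; (inj₂ _) → refl }) (λ { nothing → refl ; (just _) → refl }))
  (⊎-finite (1 , ↔-sym 1↔⊤) X-finite)

Vec-finite : ∀ {X : Set} n → Finite X → Finite (Vec X n)
Vec-finite zero    X-finite = Finite-↔ (mk↔ₛ′ (λ _ → tt) (λ _ → []) (λ _ → refl) (λ { [] → refl })) (1 , ↔-sym 1↔⊤)
Vec-finite (suc n) X-finite = Finite-↔
  (mk↔ₛ′ Vec.uncons (uncurry Vec._∷_) (λ _ → refl) (λ { (x ∷ xs) → refl }))
  (×-finite X-finite (Vec-finite n X-finite))

Move-finite : Finite Move
Move-finite = 3 , mk↔ₛ′
  (λ { left → zero ; stay → suc zero ; right → suc (suc zero) })
  (λ { zero → left ; (suc zero) → stay ; (suc (suc zero)) → right })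
  (λ { zero → refl ; (suc zero) → refl ; (suc (suc zero)) → refl })
  (λ { left → refl ; stay → refl ; right → refl })

-- Strings and formulas printed by loop programs

repeat : ∀ {B : Set} → ℕ → List B → List B
repeat k s = concat (List.replicate k s)

repeat-+ : ∀ {B : Set} j k (s : List B) → repeat (j + k) s ≡ repeat j s ++ repeat k s
repeat-+ zero    k s = refl
repeat-+ (suc j) k s = trans (cong (s ++_) (repeat-+ j k s)) (sym (++-assoc s (repeat j s) (repeat k s)))

module _ {A B : Set} where

  record Printable (n : ℕ) (f : List A → List B) : Set where
    constructor _,_
    field
      program : Program n
      prints  : ∀ w → printed program w ≡ f w

  open Printable

  private
    variable
      n : ℕ
      f g : List A → List B

  Printable-resp : (∀ w → f w ≡ g w) → Printable n f → Printable n g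
  Printable-resp f≡g (p , p≡) = p , λ w → trans (p≡ w) (f≡g w)

  Printable-const : ∀ s → Printable n (λ _ → s)
  Printable-const s = emit s , λ _ → refl

  Printable-++ : Printable n f → Printable n g → Printable n (λ w → f w ++ g w)
  Printable-++ (p , p≡) (q , q≡) = p ⨾ q , λ w → cong₂ _++_ (p≡ w) (q≡ w)

  Printable-concatMap : ∀ g → Printable (suc n) (concatMap g)
  Printable-concatMap g = for g (emit []) , concatMap-cong (λ a → ++-identityʳ (g a))

  concatMap-const : ∀ k {s : List B} (w : List A) → concatMap (λ _ → repeat k s) w ≡ repeat (length w * k) s
  concatMap-const k         []      = refl
  concatMap-const k {s = s} (a ∷ w) = trans (cong (repeat k s ++_) (concatMap-const k w))
    (sym (repeat-+ k (length w * k) s))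

  -- Each of d nested loops over the input multiplies the number of copies by its length; the
  -- innermost program prints c copies.
  Printable-power : ∀ d c s → Printable (suc d) (λ w → repeat (length w ^ d * c) s)
  Printable-power zero    c s =
    Printable-resp (λ w → cong (λ k → repeat k s) (sym (*-identityˡ c))) (Printable-const (repeat c s))
  Printable-power (suc d) c s with p , p≡ ← Printable-power d c s = for (λ _ → []) p , λ w →
    trans (concatMap-cong (λ _ → p≡ w) w) (trans (concatMap-const (length w ^ d * c) w)
      (cong (λ k → repeat k s) (sym (*-assoc (length w) (length w ^ d) c))))

  Printable-polynomial : ∀ c d s → Printable (suc d) (λ w → repeat (polynomial c d (length w)) s)
  Printable-polynomial c d s = Printable-resp
    (λ w → trans (sym (repeat-+ (length w ^ d * c) c s)) (cong (λ k → repeat (k + c) s) (*-comm (length w ^ d) c)))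
    (Printable-++ (Printable-power d c s) (Printable-const (repeat c s)))

  Printable-length : ∀ s → Printable (suc n) (λ w → repeat (length w) s)
  Printable-length s = Printable-resp count (Printable-concatMap (λ _ → s))
    where
    count : ∀ w → concatMap (λ _ → s) w ≡ repeat (length w) s
    count []      = refl
    count (a ∷ w) = cong (s ++_) (count w)

module _ {A : Set} {n k : ℕ} where

  record PrintableFormula (φ : List A → Formula k) : Set where
    constructor encoded
    field
      printable : Printable n (λ w → encodeFormula (φ w))

  open PrintableFormula public

  private
    variable
      φ ψ : List A → Formula k

  printable-const : ∀ φ → PrintableFormula (λ _ → φ)
  printable-const φ = encoded (Printable-const (encodeFormula φ))

  printable-¬ : PrintableFormula φ → PrintableFormula (λ w → ¬′ φ w)
  printable-¬ p = encoded (Printable-++ (Printable-const [ neg ]) (printable p))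

  printable-∨ : PrintableFormula φ → PrintableFormula ψ → PrintableFormula (λ w → φ w ∨′ ψ w)
  printable-∨ p q = encoded (Printable-++ (Printable-const [ disj ]) (Printable-++ (printable p) (printable q)))

  printable-F : ∀ I → PrintableFormula φ → PrintableFormula (λ w → F I (φ w))
  printable-F I p = encoded (Printable-++ (Printable-const (future ∷ encodeInterval I)) (printable p))

  printable-∧ : PrintableFormula φ → PrintableFormula ψ → PrintableFormula (λ w → φ w ∧′ ψ w)
  printable-∧ p q = printable-¬ (printable-∨ (printable-¬ p) (printable-¬ q))

  printable-byLetter : ∀ z {φ : List A → Fin k → Formula k} → (∀ a → PrintableFormula (λ w → φ w a)) →
    PrintableFormula (λ w → byLetter z (φ w))
  printable-byLetter z {φ} p = printable-case (allFin k)
    where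
    printable-case : ∀ as → PrintableFormula (λ w → case z (φ w) as)
    printable-case []       = printable-const (¬′ true′ z)
    printable-case (a ∷ as) = printable-∨ (printable-∧ (printable-const (atom a)) (p a)) (printable-case as)

module _ {k : ℕ} where

  encode-X^ : ∀ j (φ : Formula k) →
    encodeFormula (X^ j φ) ≡ repeat j (future ∷ encodeInterval nextInterval) ++ encodeFormula φ
  encode-X^ zero    φ = refl
  encode-X^ (suc j) φ = trans (cong (λ s → future ∷ encodeInterval nextInterval ++ s) (encode-X^ j φ))
    (sym (++-assoc (future ∷ encodeInterval nextInterval) (repeat j _) (encodeFormula φ)))

  -- The tokens of `X (atom x ∧′ _)` up to the hole. As the hole comes last in Polish notation, a
  -- chain is encoded by a mere concatenation of links, which a loop can print.
  link : Fin k → List Token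
  link x = (future ∷ encodeInterval nextInterval) ++ neg ∷ disj ∷ neg ∷ encodeFormula (atom x) ++ [ neg ]

  encode-chain : ∀ z xs → encodeFormula (chain z xs) ≡ concatMap link xs ++ encodeFormula (true′ z)
  encode-chain z []       = refl
  encode-chain z (x ∷ xs) = begin
    (future ∷ I) ++ neg ∷ disj ∷ neg ∷ encodeFormula (atom x) ++ neg ∷ encodeFormula (chain z xs)
      ≡⟨ cong (λ s → (future ∷ I) ++ neg ∷ disj ∷ neg ∷ s) (++-assoc (encodeFormula (atom x)) [ neg ] _) ⟨
    (future ∷ I) ++ neg ∷ disj ∷ neg ∷ (encodeFormula (atom x) ++ [ neg ]) ++ encodeFormula (chain z xs)
      ≡⟨ ++-assoc (future ∷ I) (neg ∷ disj ∷ neg ∷ encodeFormula (atom x) ++ [ neg ]) _ ⟨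
    link x ++ encodeFormula (chain z xs)
      ≡⟨ cong (link x ++_) (encode-chain z xs) ⟩
    link x ++ concatMap link xs ++ encodeFormula (true′ z)
      ≡⟨ ++-assoc (link x) (concatMap link xs) _ ⟨
    concatMap link (x ∷ xs) ++ encodeFormula (true′ z) ∎
    where
    open ≡-Reasoning
    I = encodeInterval nextInterval

module _ (L : Fragment) (upper : ∀ {I} → UpperBound I → Fragment.FutureInterval L I) {n : ℕ} where

  X^-inFragment : ∀ k {φ : Formula n} → InFragment L φ → InFragment L (X^ k φ)
  X^-inFragment zero    h = h
  X^-inFragment (suc k) h = upper [0,u⟩ , X^-inFragment k h

  chain-inFragment : ∀ (z : Fin n) xs → InFragment L (chain z xs)
  chain-inFragment z []       = tt , tt
  chain-inFragment z (x ∷ xs) = upper [0,u⟩ , tt , chain-inFragment z xs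

  byLetter-inFragment : ∀ z {ψ : Fin n → Formula n} → (∀ a → InFragment L (ψ a)) → InFragment L (byLetter z ψ)
  byLetter-inFragment z {ψ} h = case-inFragment (allFin n)
    where
    case-inFragment : ∀ as → InFragment L (case z ψ as)
    case-inFragment []       = tt , tt
    case-inFragment (a ∷ as) = (tt , h a) , case-inFragment as

  formula-inFragment : ∀ local acc k xs → InFragment L (Recurrence.formula {n} local acc k xs)
  formula-inFragment local acc k xs = chain-inFragment acc xs , upper [0,∞⟩ , (upper [0,u⟩ , tt , tt) , tt ,
    byLetter-inFragment acc λ a → upper [0,u⟩ , byLetter-inFragment acc λ b → upper [0,u⟩ ,
    byLetter-inFragment acc λ c →
      X^-inFragment k (byLetter-inFragment acc λ e → upper [0,u⟩ , tt)

Prefix-map : ∀ {X Y : Set} (h : X → Y) xs {s} → Prefix xs s → Prefix (map h xs) (h ∘ s)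
Prefix-map h []       _        = tt
Prefix-map h (x ∷ xs) (e , es) = cong h e , Prefix-map h xs es

module Reduction {A : Set} (A-finite : Finite A) (M : Machine A ⊥) (c d : ℕ) where

  open Machine M using (finiteState; finiteWork; tapes)
  open Simulation M

  Symbol-finite : Finite (Machine.Symbol M)
  Symbol-finite = Maybe-finite (⊎-finite A-finite finiteWork)

  abstract
    Letter-finite : Finite Letter
    Letter-finite = ⊎-finite (2 , ↔-sym 2↔Bool)
      (×-finite (Maybe-finite (Maybe-finite finiteState))
        (×-finite (Vec-finite tapes (×-finite Symbol-finite Move-finite))
          (Vec-finite tapes (×-finite Symbol-finite Symbol-finite))))

  alphabet : ℕ
  alphabet = proj₁ Letter-finite

  open Inverse (proj₂ Letter-finite) using (strictlyInverseʳ) renaming (to to code; from to decode) public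

  codedLocal : Fin alphabet → Fin alphabet → Fin alphabet → Fin alphabet → Fin alphabet
  codedLocal a b c e = code (local (decode a) (decode b) (decode c) (decode e))

  acc : Fin alphabet
  acc = code (verdict true)

  padding : List A → ℕ
  padding w = polynomial c d (length w)

  -- The first block has a control letter, the input and `suc (padding w)` blanks, hence length
  -- `2 + offset w`. Taking a sum makes the blanks printable by nested loops, independently of the
  -- room that the input occupies.
  offset : List A → ℕ
  offset w = length w + padding w

  module Rec (w : List A) = Recurrence codedLocal acc (offset w)

  beginning : List A → List (Fin alphabet)
  beginning w = map code (letters w (suc (padding w)))

  formula : List A → Formula alphabet
  formula w = Rec.formula w (code blankLetter ∷ beginning w)

  beginning-length : ∀ w → length (beginning w) ≡ 2 + offset w
  beginning-length w = trans (length-map code (letters w _)) (cong suc (begin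
    length (map inputLetter w ++ List.replicate (suc (padding w)) blankLetter)
      ≡⟨ length-++ (map inputLetter w) ⟩
    length (map inputLetter w) + length (List.replicate (suc (padding w)) blankLetter)
      ≡⟨ cong₂ _+_ (length-map inputLetter w) (length-replicate (suc (padding w))) ⟩
    length w + suc (padding w)
      ≡⟨ +-suc (length w) (padding w) ⟩
    suc (offset w) ∎))
    where open ≡-Reasoning

  code-injective : ∀ {x y} → code x ≡ code y → x ≡ y
  code-injective {x} {y} e = trans (sym (strictlyInverseʳ x)) (trans (cong decode e) (strictlyInverseʳ y))

  code-local : ∀ a b c e → codedLocal (code a) (code b) (code c) (code e) ≡ code (local a b c e)
  code-local a b c e rewrite strictlyInverseʳ a | strictlyInverseʳ b | strictlyInverseʳ c | strictlyInverseʳ e = refl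

  module _ {w} (r : Run M (initial M w)) (fits : space r ≤ polynomial c d (length w)) where

    private
      letters-length : length (letters w (suc (padding w))) ≡ 2 + offset w
      letters-length = trans (sym (length-map code (letters w (suc (padding w))))) (beginning-length w)

      simulated = simulation r (offset w) (suc (padding w))
        (≤-trans fits (≤-trans (m≤n+m (padding w) (length w)) (n≤1+n (offset w)))) (≤-reflexive letters-length)

      s : ℕ → Letter
      s = proj₁ simulated

    coded : ℕ → Fin alphabet
    coded t = code (s t)

    coded-recurrent : Rec.Recurrent w coded
    coded-recurrent t = trans (cong code (proj₁ (proj₂ simulated) t))
      (sym (code-local (s t) (s (1 + t)) (s (2 + t)) (s (2 + (offset w + t)))))

    coded-prefix : Prefix (code blankLetter ∷ beginning w) coded
    coded-prefix = Prefix-map code (blankLetter ∷ letters w (suc (padding w))) {s} (proj₁ (proj₂ (proj₂ simulated)))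

    accepting⇒satisfiable : accepts r ≡ true → Satisfiable (formula w)
    accepting⇒satisfiable e with v , accepted ← proj₁ (proj₂ (proj₂ (proj₂ simulated))) e =
      word , satisfied (code blankLetter ∷ beginning w) long coded-prefix
      where
      open Rec.Completeness w coded coded-recurrent v (λ t → cong code (accepted t))
      long = ≤-trans (≤-reflexive (cong suc (beginning-length w))) (s≤s (s≤s (s≤s (m≤m+n (offset w) v))))

    -- Acceptance is a Boolean, so refuting `accepts r ≡ false` suffices; no witness has to be
    -- extracted from the model.
    satisfiable⇒accepting : Satisfiable (formula w) → accepts r ≡ true
    satisfiable⇒accepting (ρ , h) = ¬-not λ e →
      Rec.Soundness.unsatisfied w ρ (beginning w) (≤-reflexive (cong suc (sym (beginning-length w))))
        coded-prefix coded-recurrent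
        (λ t e′ → proj₂ (proj₂ (proj₂ (proj₂ simulated))) e t (code-injective e′)) h

  beginning-printable : Printable (suc d) (λ w → concatMap link (beginning w))
  beginning-printable = Printable-resp (λ w → sym (split w))
    (Printable-++ (Printable-const (link (code startLetter)))
      (Printable-++ (Printable-concatMap (link ∘ code ∘ inputLetter))
        (Printable-++ (Printable-const (link (code blankLetter))) (Printable-polynomial c d (link (code blankLetter))))))
    where
    open ≡-Reasoning
    split : ∀ w → concatMap link (beginning w) ≡
      link (code startLetter) ++ concatMap (link ∘ code ∘ inputLetter) w ++
        repeat (suc (padding w)) (link (code blankLetter))
    split w = cong (link (code startLetter) ++_) (begin
      concatMap link (map code (map inputLetter w ++ List.replicate b blankLetter))
        ≡⟨ concatMap-map link code (map inputLetter w ++ List.replicate b blankLetter) ⟩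
      concatMap (link ∘ code) (map inputLetter w ++ List.replicate b blankLetter)
        ≡⟨ concatMap-++ (link ∘ code) (map inputLetter w) _ ⟩
      concatMap (link ∘ code) (map inputLetter w) ++ concatMap (link ∘ code) (List.replicate b blankLetter)
        ≡⟨ cong₂ _++_ (concatMap-map (link ∘ code) inputLetter w)
             (cong concat (List.map-replicate (link ∘ code) b blankLetter)) ⟩
      concatMap (link ∘ code ∘ inputLetter) w ++ repeat b (link (code blankLetter)) ∎)
      where b = suc (padding w)

  chain-printable : PrintableFormula {A} {suc d} λ w → chain acc (code blankLetter ∷ beginning w)
  chain-printable = encoded (Printable-resp (λ w → sym (encode-chain acc (code blankLetter ∷ beginning w)))
    (Printable-++ (Printable-++ (Printable-const (link (code blankLetter))) beginning-printable)
      (Printable-const (encodeFormula (true′ acc)))))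

  X^-printable : (φ : Formula alphabet) → PrintableFormula {A} {suc d} λ w → X^ (offset w) φ
  X^-printable φ = encoded (Printable-resp
    (λ w → trans (cong (_++ encodeFormula φ) (sym (repeat-+ (length w) (padding w) s))) (sym (encode-X^ (offset w) φ)))
    (Printable-++ (Printable-++ (Printable-length s) (Printable-polynomial c d s)) (Printable-const (encodeFormula φ))))
    where s = future ∷ encodeInterval nextInterval

  formula-printable : PrintableFormula {A} {suc d} formula
  formula-printable = printable-∧ chain-printable
    (printable-¬ (printable-F anyInterval (printable-¬ (printable-∧ (printable-const (spaced acc))
      (printable-∨ (printable-const (atom acc)) (printable-byLetter acc λ a → printable-F nextInterval
        (printable-byLetter acc λ b → printable-F nextInterval (printable-byLetter acc λ c →
          X^-printable (byLetter acc λ e → X (atom (codedLocal a b c e)))))))))))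

  encoding-printable : Printable (suc d) (λ w → encode alphabet (formula w))
  encoding-printable = Printable-++ (Printable-const (encodeUnary alphabet)) (printable formula-printable)

Satisfiable-encode : ∀ {k l} {φ : Formula k} {ψ : Formula l} → encode k φ ≡ encode l ψ →
  Satisfiable φ → Satisfiable ψ
Satisfiable-encode {k} {l} {φ} {ψ} e sat with refl ← encode-injective {k} {l} {φ} {ψ} e = sat

-- All intervals of the constructed formula are upper bounds, so a single reduction serves every
-- fragment that admits these for F.
Satisfiability-hard : ∀ 𝓛 → (∀ {I} → UpperBound I → Fragment.FutureInterval 𝓛 I) →
  PSPACE-hard (Satisfiability 𝓛)
Satisfiability-hard 𝓛 upper {A} A-finite K (M , c , d , decides) =
  printed program , printed-polynomialTime program , λ w →
    let r , fits , K⇔ = decides w in mk⇔ (to w r fits ∘ Equivalence.to K⇔) (Equivalence.from K⇔ ∘ from w r fits)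
  where
  open Reduction A-finite M c d
  open Printable encoding-printable

  module _ (w : List A) (r : Run M (initial M w)) (fits : space r ≤ polynomial c d (length w)) where

    to : accepts r ≡ true → Satisfiability 𝓛 (printed program w)
    to e = alphabet , formula w ,
      formula-inFragment 𝓛 upper codedLocal acc (offset w) (code (Simulation.blankLetter M) ∷ beginning w) ,
      prints w , accepting⇒satisfiable r fits e

    from : Satisfiability 𝓛 (printed program w) → accepts r ≡ true
    from (k , φ , _ , e , sat) = satisfiable⇒accepting r fits
      (Satisfiable-encode {k} {alphabet} {φ} {formula w} (trans (sym e) (prints w)) sat)

theorem7 :
  PSPACE-hard (Satisfiability MITL[F₀])
    × PSPACE-hard (Satisfiability MITL[F₀,∞])
    × PSPACE-hard (Satisfiability MITL[F₀,∞,P₀,∞])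
theorem7 = Satisfiability-hard _ (λ u → u)
         , Satisfiability-hard _ oneSided
         , Satisfiability-hard _ oneSided
  where
  oneSided : ∀ {I} → UpperBound I → OneSided I
  oneSided [0,u⟩ = [0,u⟩
  oneSided [0,∞⟩ = ⟨l,∞⟩
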